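{- Let $a,a',b,\ell,s,N,k,\Delta^-$ be positive integers with $k\ge 2$ and $2a'\ge a$, and let $T$ be a tournament on $N$ vertices with a median order $v_1,\dots,v_N$. Let $j$ be an integer with $2ka'<j\le N-a+1$ and let $B\subseteq[j,j+a)$ be an arbitrary subset of size at least $b$. Then there exist an integer $j'$ with $j-2ka'\le j'\le j-a'$ and a set $A\subseteq[j',j'+a')$ such that - $|A|\ge \frac{a'}{2}\left(\frac{k-1}{2k}\right)^{\ell}$, and - for all but at most $4\left(\frac{2k}{k-1}\right)^{\ell}\binom{a'}{\Delta^- }\left(\frac{s}{b}\right)^{\ell}$ subsets $S\subseteq A$ with $|S|=\Delta^-$, we have $|N^+(S)\cap B|\ge s+1$.
   Context: A tournament on $N$ vertices is an orientation of the edges of the complete graph $K_N$. A median order of a tournament $T$ is an ordering $v_1,\dots,v_N$ of its vertices that maximizes the number of forward edges, i.e. edges directed from $v_i$ to $v_j$ with $i<j$. Given a median order, $[i,j)$ denotes the vertex set $\{v_i,\dots,v_{j-1}\}$. For a set $S$ of vertices, $N^+(S)$ denotes the common out-neighborhood of $S$ in $T$, i.e. the set of vertices that are out-neighbors of every vertex of $S$. -}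

module Defs where

open import Data.Fin.Base using (Fin; toℕ)
open import Data.Fin.Permutation using (Permutation′; _⟨$⟩ʳ_; _⟨$⟩ˡ_)
open import Data.Fin.Properties using (all?) renaming (_<?_ to _<ᶠ?_)
open import Data.Fin.Subset using (Subset; inside; outside; _⊆_; _∩_; ∣_∣)
open import Data.Fin.Subset.Properties using (_∈?_; _⊆?_)
open import Data.Integer.Base using (+_)
open import Data.List.Base using (List; []; _∷_; _++_; map; filter; length; allFin; cartesianProduct)
open import Data.Nat.Base using (ℕ; zero; suc; _+_; _*_; _∸_; _≤_; NonTrivial; >-nonZero; nonTrivial⇒nonZero; nonTrivial⇒n>1)
open import Data.Nat.Properties using (_≟_; _≤?_; _<?_; m*n≢0; m<n⇒0<n∸m)
open import Data.Product.Base using (_×_; _,_)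
open import Data.Rational.Base as ℚ using (ℚ; _/_)
open import Data.Vec.Base using (tabulate) renaming ([] to []ᵛ; _∷_ to _∷ᵛ_)
open import Level using (Level; 0ℓ)
open import Relation.Binary.Core using (Rel)
open import Relation.Binary.Consequences using (tri⇒dec<)
open import Relation.Binary.Definitions using (Trichotomous) renaming (Decidable to Decidable₂)
open import Relation.Binary.PropositionalEquality.Core using (_≡_)
open import Relation.Nullary using (¬_; does)
open import Relation.Nullary.Decidable using (¬?; _×-dec_; _→-dec_)
open import Relation.Unary using (Pred; Decidable)

-- Trichotomy says that for every pair of vertices exactly one of u ⟶ v, u ≡ v,
-- v ⟶ u holds; it also makes adjacency decidable.
record Tournament (N : ℕ) : Set₁ where
  infix 4 _⟶_ _⟶?_
  field
    _⟶_     : Rel (Fin N) 0ℓ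
    compare : Trichotomous _≡_ _⟶_

  _⟶?_ : Decidable₂ _⟶_
  _⟶?_ = tri⇒dec< compare

⟦_⟧ : ∀ {n} {p : Level} {P : Pred (Fin n) p} → Decidable P → Subset n
⟦ P? ⟧ = tabulate (λ x → does (P? x))

subsets : ∀ n → List (Subset n)
subsets zero    = []ᵛ ∷ []
subsets (suc n) = map (inside ∷ᵛ_) (subsets n) ++ map (outside ∷ᵛ_) (subsets n)

module _ {N : ℕ} where

  -- An ordering sends positions to vertices. Positions in Fin N count from 0,
  -- so the vertex written v_{i+1} in 1-based notation is σ ⟨$⟩ʳ i.
  Ordering : Set
  Ordering = Permutation′ N

  index : Ordering → Fin N → ℕ
  index σ v = suc (toℕ (σ ⟨$⟩ˡ v))

  module _ (T : Tournament N) where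
    open Tournament T

    forwardEdges : Ordering → ℕ
    forwardEdges σ =
      length (filter (λ (i , j) → (i <ᶠ? j) ×-dec (σ ⟨$⟩ʳ i ⟶? σ ⟨$⟩ʳ j))
                     (cartesianProduct (allFin N) (allFin N)))

    IsMedianOrder : Ordering → Set
    IsMedianOrder σ = ∀ τ → forwardEdges τ ≤ forwardEdges σ

    N⁺ : Subset N → Subset N
    N⁺ S = ⟦ (λ w → all? (λ v → (v ∈? S) →-dec (v ⟶? w))) ⟧

    Exceptional : (A B : Subset N) (Δ s : ℕ) → Pred (Subset N) 0ℓ
    Exceptional A B Δ s S = S ⊆ A × ∣ S ∣ ≡ Δ × ¬ (s + 1 ≤ ∣ N⁺ S ∩ B ∣)

    exceptional? : ∀ A B Δ s → Decidable (Exceptional A B Δ s)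
    exceptional? A B Δ s S =
      (S ⊆? A) ×-dec (∣ S ∣ ≟ Δ) ×-dec ¬? (s + 1 ≤? ∣ N⁺ S ∩ B ∣)

    #exceptional : (A B : Subset N) (Δ s : ℕ) → ℕ
    #exceptional A B Δ s = length (filter (exceptional? A B Δ s) (subsets N))

  -- The vertices v_i, …, v_{j-1}, with 1-based indices.
  interval : Ordering → ℕ → ℕ → Subset N
  interval σ i j = ⟦ (λ v → (i ≤? index σ v) ×-dec (index σ v <? j)) ⟧

open import Algebra.Definitions.RawSemiring ℚ.+-*-rawSemiring public using (_^_)

fromℕ : ℕ → ℚ
fromℕ n = + n / 1

[k-1]/[2k] : (k : ℕ) .{{_ : NonTrivial k}} → ℚ
[k-1]/[2k] k = _/_ (+ (k ∸ 1)) (2 * k) {{m*n≢0 2 k {{_}} {{nonTrivial⇒nonZero k}}}}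

[2k]/[k-1] : (k : ℕ) .{{_ : NonTrivial k}} → ℚ
[2k]/[k-1] k = _/_ (+ (2 * k)) (k ∸ 1) {{>-nonZero (m<n⇒0<n∸m (nonTrivial⇒n>1 k))}}

{-# OPTIONS --safe #-}

-- Moving a vertex forward in a median order cannot gain forward edges, so every
-- vertex receives at least half of the edges from any interval just before it.
-- Hence each vertex of B has at least (k - 1)a′ in-neighbours in the window
-- W = [j - 2ka′, j).  Dependent random choice: for ℓ random vertices of B, the
-- expected number of common in-neighbours in W is, by convexity, at least
-- 2ka′((k-1)/2k)^ℓ, while in each of the 2k blocks of W the expected number of
-- exceptional Δ⁻-subsets is at most (a′ C Δ⁻)(s/b)^ℓ.  Averaging over the blocks
-- and the ℓ-tuples a linear combination of the two counts gives j′ and A.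
module Submission where

open import Defs hiding (_^_)
open import Algebra.Properties.CommutativeMonoid.Sum using (sum-remove; sum-permute)
open import Data.Bool.Base using (true; false; if_then_else_)
open import Data.Fin.Base as Fin using (Fin; zero; suc; toℕ; fromℕ<; punchIn)
open import Data.Fin.Permutation as Perm
  using (Permutation′; _⟨$⟩ʳ_; _⟨$⟩ˡ_; inverseˡ; inverseʳ; insert; insert-punchIn; _∘ₚ_)
open import Data.Fin.Properties
  using (punchIn-cancel-≤; punchIn-mono-≤; punchInᵢ≢i; toℕ<n; toℕ-fromℕ<)
  renaming (_<?_ to _<ᶠ?_; _≟_ to _≟ᶠ_; all? to allᶠ?)
open import Data.Fin.Subset using (Subset; inside; outside; _∈_; _⊆_; _∩_; ∣_∣)
open import Data.Fin.Subset.Properties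
  using (_∈?_; _⊆?_; drop-∷-⊆; s⊆s; out⊆; x∈p∩q⁺; p⊆q⇒∣p∣≤∣q∣)
open import Data.List.Base
  using (List; []; _∷_; _++_; map; filter; length; allFin; tabulate; cartesianProduct; cartesianProductWith)
open import Data.List.Membership.Propositional renaming (_∈_ to _∈ˡ_)
open import Data.List.Membership.Propositional.Properties using (∈-filter⁻)
open import Data.List.Properties using (map-tabulate; map-∘; length-++; length-map)
open import Data.List.Relation.Unary.All as All using (All; all?)
open import Data.List.Relation.Unary.Any using (here; there)
open import Data.Nat.Base
  using (ℕ; zero; suc; _+_; _∸_; _≤_; _<_; z≤n; s≤s; z<s; s≤s⁻¹; NonZero; NonTrivial; >-nonZero; >-nonZero⁻¹)
open import Data.Nat.Combinatorics using (_C_; nCk+nC[k+1]≡[n+1]C[k+1])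
open import Data.Nat.ListAction using (sum)
open import Data.Nat.Properties
open import Data.Nat.Tactic.RingSolver using (solve-∀)
open import Data.Product.Base using (∃-syntax; _×_; _,_; proj₁; proj₂)
open import Data.Sum.Base using (inj₁; inj₂)
open import Data.Vec.Base renaming ([] to []ᵛ; _∷_ to _∷ᵛ_; here to hereᵛ) using ()
open import Data.Vec.Functional as Vector using ()
open import Data.Vec.Properties using ([]=⇒lookup; lookup⇒[]=; lookup∘tabulate)
open import Function.Base using (_∘_; id)
open import Level using (0ℓ)
open import Relation.Binary.Definitions using (tri<; tri≈; tri>)
open import Relation.Binary.PropositionalEquality
open import Relation.Nullary using (Dec; yes; no; does; ¬_; contradiction)
open import Relation.Nullary.Decidable using (_×-dec_; _→-dec_; dec-true; dec-false)
open import Relation.Unary using (Pred; Decidable)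

module _ where
  open import Data.Nat.Base using (_*_; _^_)

  private
    variable
      A B D : Set

  𝟙 : Dec A → ℕ
  𝟙 a? = if does a? then 1 else 0

  𝟙-yes : (a? : Dec A) → A → 𝟙 a? ≡ 1
  𝟙-yes a? a rewrite dec-true a? a = refl

  𝟙-no : (a? : Dec A) → ¬ A → 𝟙 a? ≡ 0
  𝟙-no a? ¬a rewrite dec-false a? ¬a = refl

  𝟙≤1 : (a? : Dec A) → 𝟙 a? ≤ 1
  𝟙≤1 (yes _) = ≤-refl
  𝟙≤1 (no _)  = z≤n

  𝟙-mono : (a? : Dec A) (b? : Dec B) → (A → B) → 𝟙 a? ≤ 𝟙 b?
  𝟙-mono (yes a) b? f = ≤-reflexive (sym (𝟙-yes b? (f a)))
  𝟙-mono (no _)  b? f = z≤n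

  𝟙-cong : (a? : Dec A) (b? : Dec B) → (A → B) → (B → A) → 𝟙 a? ≡ 𝟙 b?
  𝟙-cong a? b? f g = ≤-antisym (𝟙-mono a? b? f) (𝟙-mono b? a? g)

  𝟙-× : (a? : Dec A) (b? : Dec B) → 𝟙 (a? ×-dec b?) ≡ 𝟙 a? * 𝟙 b?
  𝟙-× (yes _) b? = sym (+-identityʳ _)
  𝟙-× (no _)  b? = refl

  ∑ : List A → (A → ℕ) → ℕ
  ∑ xs f = sum (map f xs)

  ∑-cong : ∀ (xs : List A) {f g : A → ℕ} → (∀ x → f x ≡ g x) → ∑ xs f ≡ ∑ xs g
  ∑-cong []       f≡g = refl
  ∑-cong (x ∷ xs) f≡g = cong₂ _+_ (f≡g x) (∑-cong xs f≡g)

  ∑-mono : ∀ (xs : List A) {f g : A → ℕ} → (∀ x → f x ≤ g x) → ∑ xs f ≤ ∑ xs g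
  ∑-mono []       f≤g = z≤n
  ∑-mono (x ∷ xs) f≤g = +-mono-≤ (f≤g x) (∑-mono xs f≤g)

  ∑-mono-∈ : ∀ (xs : List A) {f g : A → ℕ} → (∀ {x} → x ∈ˡ xs → f x ≤ g x) → ∑ xs f ≤ ∑ xs g
  ∑-mono-∈ []       f≤g = z≤n
  ∑-mono-∈ (x ∷ xs) f≤g = +-mono-≤ (f≤g (here refl)) (∑-mono-∈ xs (f≤g ∘ there))

  ∑-const : ∀ (xs : List A) c → ∑ xs (λ _ → c) ≡ length xs * c
  ∑-const []       c = refl
  ∑-const (x ∷ xs) c = cong (c +_) (∑-const xs c)

  ∑-distrib-+ : ∀ (xs : List A) (f g : A → ℕ) → ∑ xs (λ x → f x + g x) ≡ ∑ xs f + ∑ xs g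
  ∑-distrib-+ []       f g = refl
  ∑-distrib-+ (x ∷ xs) f g = begin
    f x + g x + ∑ xs (λ y → f y + g y)  ≡⟨ cong (f x + g x +_) (∑-distrib-+ xs f g) ⟩
    f x + g x + (∑ xs f + ∑ xs g)       ≡⟨ interchange (f x) (g x) (∑ xs f) (∑ xs g) ⟩
    f x + ∑ xs f + (g x + ∑ xs g)       ∎
    where
    open ≡-Reasoning
    interchange : ∀ a b c d → a + b + (c + d) ≡ a + c + (b + d)
    interchange = solve-∀

  *-distribˡ-∑ : ∀ c (xs : List A) (f : A → ℕ) → c * ∑ xs f ≡ ∑ xs (λ x → c * f x)
  *-distribˡ-∑ c []       f = *-zeroʳ c
  *-distribˡ-∑ c (x ∷ xs) f = begin
    c * (f x + ∑ xs f)                ≡⟨ *-distribˡ-+ c (f x) (∑ xs f) ⟩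
    c * f x + c * ∑ xs f              ≡⟨ cong (c * f x +_) (*-distribˡ-∑ c xs f) ⟩
    c * f x + ∑ xs (λ y → c * f y)    ∎
    where open ≡-Reasoning

  *-distribʳ-∑ : ∀ c (xs : List A) (f : A → ℕ) → ∑ xs f * c ≡ ∑ xs (λ x → f x * c)
  *-distribʳ-∑ c xs f = begin
    ∑ xs f * c              ≡⟨ *-comm (∑ xs f) c ⟩
    c * ∑ xs f              ≡⟨ *-distribˡ-∑ c xs f ⟩
    ∑ xs (λ x → c * f x)    ≡⟨ ∑-cong xs (λ x → *-comm c (f x)) ⟩
    ∑ xs (λ x → f x * c)    ∎
    where open ≡-Reasoning

  ∑-comm : ∀ (xs : List A) (ys : List B) (f : A → B → ℕ) →
           ∑ xs (λ x → ∑ ys (f x)) ≡ ∑ ys (λ y → ∑ xs (λ x → f x y))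
  ∑-comm []       ys f = sym (trans (∑-const ys 0) (*-zeroʳ (length ys)))
  ∑-comm (x ∷ xs) ys f = begin
    ∑ ys (f x) + ∑ xs (λ z → ∑ ys (f z))             ≡⟨ cong (∑ ys (f x) +_) (∑-comm xs ys f) ⟩
    ∑ ys (f x) + ∑ ys (λ y → ∑ xs (λ z → f z y))     ≡⟨ ∑-distrib-+ ys (f x) _ ⟨
    ∑ ys (λ y → f x y + ∑ xs (λ z → f z y))          ∎
    where open ≡-Reasoning

  ∑-++ : ∀ (xs ys : List A) (f : A → ℕ) → ∑ (xs ++ ys) f ≡ ∑ xs f + ∑ ys f
  ∑-++ []       ys f = refl
  ∑-++ (x ∷ xs) ys f = trans (cong (f x +_) (∑-++ xs ys f)) (sym (+-assoc (f x) _ _))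

  ∑-map : ∀ (g : A → B) (xs : List A) (f : B → ℕ) → ∑ (map g xs) f ≡ ∑ xs (f ∘ g)
  ∑-map g xs f = cong sum (sym (map-∘ xs))

  ∑-filter : ∀ {P : Pred A 0ℓ} (P? : Decidable P) xs (f : A → ℕ) →
             ∑ (filter P? xs) f ≡ ∑ xs (λ x → 𝟙 (P? x) * f x)
  ∑-filter P? []       f = refl
  ∑-filter P? (x ∷ xs) f with does (P? x)
  ... | true  = cong₂ _+_ (sym (+-identityʳ (f x))) (∑-filter P? xs f)
  ... | false = ∑-filter P? xs f

  length-filter : ∀ {P : Pred A 0ℓ} (P? : Decidable P) xs → length (filter P? xs) ≡ ∑ xs (λ x → 𝟙 (P? x))
  length-filter P? []       = refl
  length-filter P? (x ∷ xs) with does (P? x)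
  ... | true  = cong suc (length-filter P? xs)
  ... | false = length-filter P? xs

  ∑-cartesianProductWith : ∀ (g : A → B → D) xs ys (f : D → ℕ) →
                           ∑ (cartesianProductWith g xs ys) f ≡ ∑ xs (λ x → ∑ ys (f ∘ g x))
  ∑-cartesianProductWith g []       ys f = refl
  ∑-cartesianProductWith g (x ∷ xs) ys f = begin
    ∑ (map (g x) ys ++ cartesianProductWith g xs ys) f           ≡⟨ ∑-++ (map (g x) ys) _ f ⟩
    ∑ (map (g x) ys) f + ∑ (cartesianProductWith g xs ys) f      ≡⟨ cong₂ _+_ (∑-map (g x) ys f) (∑-cartesianProductWith g xs ys f) ⟩
    ∑ ys (f ∘ g x) + ∑ xs (λ x → ∑ ys (f ∘ g x))                 ∎
    where open ≡-Reasoning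

  ∑-<⇒∃< : ∀ (xs : List A) {f g : A → ℕ} → ∑ xs f < ∑ xs g → ∃[ x ] x ∈ˡ xs × f x < g x
  ∑-<⇒∃< (x ∷ xs) {f} {g} ∑f<∑g with f x <? g x
  ... | yes fx<gx = x , here refl , fx<gx
  ... | no  fx≮gx = let y , y∈xs , fy<gy = ∑-<⇒∃< xs (≰⇒> ∑g≰∑f) in y , there y∈xs , fy<gy
    where
    ∑g≰∑f : ¬ ∑ xs g ≤ ∑ xs f
    ∑g≰∑f ∑g≤∑f = <⇒≱ ∑f<∑g (+-mono-≤ (≮⇒≥ fx≮gx) ∑g≤∑f)

  ∑-allFin : ∀ {n} (f : Fin n → ℕ) → ∑ (allFin n) f ≡ Vector.foldr _+_ 0 f
  ∑-allFin {n} f = trans (cong sum (map-tabulate id f)) (sum-tabulate f)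
    where
    sum-tabulate : ∀ {n} (f : Fin n → ℕ) → sum (tabulate f) ≡ Vector.foldr _+_ 0 f
    sum-tabulate {zero}  f = refl
    sum-tabulate {suc n} f = cong (f zero +_) (sum-tabulate (f ∘ suc))

  ∑-punchIn : ∀ {n} (i : Fin (suc n)) (f : Fin (suc n) → ℕ) →
              ∑ (allFin (suc n)) f ≡ f i + ∑ (allFin n) (f ∘ punchIn i)
  ∑-punchIn i f = begin
    ∑ (allFin _) f                               ≡⟨ ∑-allFin f ⟩
    Vector.foldr _+_ 0 f                         ≡⟨ sum-remove +-0-commutativeMonoid {i = i} f ⟩
    f i + Vector.foldr _+_ 0 (f ∘ punchIn i)     ≡⟨ cong (f i +_) (∑-allFin (f ∘ punchIn i)) ⟨
    f i + ∑ (allFin _) (f ∘ punchIn i)           ∎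
    where open ≡-Reasoning

  ∑-permute : ∀ {n} (π : Permutation′ n) (f : Fin n → ℕ) → ∑ (allFin n) f ≡ ∑ (allFin n) (f ∘ (π ⟨$⟩ʳ_))
  ∑-permute π f = begin
    ∑ (allFin _) f                          ≡⟨ ∑-allFin f ⟩
    Vector.foldr _+_ 0 f                    ≡⟨ sum-permute +-0-commutativeMonoid f π ⟩
    Vector.foldr _+_ 0 (f ∘ (π ⟨$⟩ʳ_))      ≡⟨ ∑-allFin (f ∘ (π ⟨$⟩ʳ_)) ⟨
    ∑ (allFin _) (f ∘ (π ⟨$⟩ʳ_))            ∎
    where open ≡-Reasoning

  ∑-suc : ∀ {n} (f : Fin (suc n) → ℕ) → ∑ (allFin (suc n)) f ≡ f zero + ∑ (allFin n) (f ∘ suc)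
  ∑-suc = ∑-punchIn zero

  ∑-∑-punchIn : ∀ {n} (i : Fin (suc n)) (f : Fin (suc n) → Fin (suc n) → ℕ) →
                ∑ (allFin (suc n)) (λ x → ∑ (allFin (suc n)) (f x)) ≡
                f i i + ∑ (allFin n) (λ y → f i (punchIn i y)) +
                (∑ (allFin n) (λ x → f (punchIn i x) i) +
                 ∑ (allFin n) (λ x → ∑ (allFin n) (λ y → f (punchIn i x) (punchIn i y))))
  ∑-∑-punchIn {n} i f = begin
    ∑ (allFin (suc n)) (λ x → ∑ (allFin (suc n)) (f x))
      ≡⟨ ∑-punchIn i _ ⟩
    ∑ (allFin (suc n)) (f i) + ∑ (allFin n) (λ x → ∑ (allFin (suc n)) (f (punchIn i x)))
      ≡⟨ cong₂ _+_ (∑-punchIn i (f i)) (∑-cong (allFin n) (λ x → ∑-punchIn i (f (punchIn i x)))) ⟩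
    f i i + ∑ (allFin n) (λ y → f i (punchIn i y)) +
    ∑ (allFin n) (λ x → f (punchIn i x) i + ∑ (allFin n) (λ y → f (punchIn i x) (punchIn i y)))
      ≡⟨ cong (f i i + ∑ (allFin n) (λ y → f i (punchIn i y)) +_) (∑-distrib-+ (allFin n) _ _) ⟩
    _ ∎
    where open ≡-Reasoning

  ∣p∣≡∑ : ∀ {n} (s : Subset n) → ∣ s ∣ ≡ ∑ (allFin n) (λ x → 𝟙 (x ∈? s))
  ∣p∣≡∑ {zero} []ᵛ = refl
  ∣p∣≡∑ {suc n} (x ∷ᵛ s) = trans (lemma x) (sym (∑-suc (λ y → 𝟙 (y ∈? (x ∷ᵛ s)))))
    where
    lemma : ∀ x → ∣ x ∷ᵛ s ∣ ≡ 𝟙 (zero ∈? (x ∷ᵛ s)) + ∑ (allFin n) (λ y → 𝟙 (suc y ∈? (x ∷ᵛ s)))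
    lemma true  = cong suc (∣p∣≡∑ s)
    lemma false = ∣p∣≡∑ s

  module _ {n} {P : Pred (Fin n) 0ℓ} (P? : Decidable P) where

    ∈⟦⟧⁺ : ∀ {x} → P x → x ∈ ⟦ P? ⟧
    ∈⟦⟧⁺ {x} px = lookup⇒[]= x ⟦ P? ⟧ (trans (lookup∘tabulate _ x) (dec-true (P? x) px))

    ∈⟦⟧⁻ : ∀ {x} → x ∈ ⟦ P? ⟧ → P x
    ∈⟦⟧⁻ {x} x∈ with P? x | trans (sym (lookup∘tabulate (λ y → does (P? y)) x)) ([]=⇒lookup x∈)
    ... | yes px | _ = px

    ∣⟦⟧∣ : ∣ ⟦ P? ⟧ ∣ ≡ ∑ (allFin n) (λ x → 𝟙 (P? x))
    ∣⟦⟧∣ = trans (∣p∣≡∑ ⟦ P? ⟧) (∑-cong (allFin n) (λ x → 𝟙-cong (x ∈? ⟦ P? ⟧) (P? x) ∈⟦⟧⁻ ∈⟦⟧⁺))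

  tuples : List A → ℕ → List (List A)
  tuples xs zero    = [] ∷ []
  tuples xs (suc ℓ) = cartesianProductWith _∷_ xs (tuples xs ℓ)

  ∑-tuples : ∀ {P : Pred A 0ℓ} (P? : Decidable P) (xs : List A) ℓ →
             ∑ (tuples xs ℓ) (λ ts → 𝟙 (all? P? ts)) ≡ ∑ xs (λ x → 𝟙 (P? x)) ^ ℓ
  ∑-tuples P? xs zero    = refl
  ∑-tuples P? xs (suc ℓ) = begin
    ∑ (cartesianProductWith _∷_ xs (tuples xs ℓ)) (λ ts → 𝟙 (all? P? ts))
      ≡⟨ ∑-cartesianProductWith _∷_ xs (tuples xs ℓ) _ ⟩
    ∑ xs (λ x → ∑ (tuples xs ℓ) (λ ts → 𝟙 (P? x ×-dec all? P? ts)))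
      ≡⟨ ∑-cong xs (λ x → ∑-cong (tuples xs ℓ) (λ ts → 𝟙-× (P? x) (all? P? ts))) ⟩
    ∑ xs (λ x → ∑ (tuples xs ℓ) (λ ts → 𝟙 (P? x) * 𝟙 (all? P? ts)))
      ≡⟨ ∑-cong xs (λ x → *-distribˡ-∑ (𝟙 (P? x)) (tuples xs ℓ) _) ⟨
    ∑ xs (λ x → 𝟙 (P? x) * ∑ (tuples xs ℓ) (λ ts → 𝟙 (all? P? ts)))
      ≡⟨ ∑-cong xs (λ x → cong (𝟙 (P? x) *_) (∑-tuples P? xs ℓ)) ⟩
    ∑ xs (λ x → 𝟙 (P? x) * ∑ xs (λ x → 𝟙 (P? x)) ^ ℓ)
      ≡⟨ *-distribʳ-∑ (∑ xs (λ x → 𝟙 (P? x)) ^ ℓ) xs _ ⟨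
    ∑ xs (λ x → 𝟙 (P? x)) * ∑ xs (λ x → 𝟙 (P? x)) ^ ℓ ∎
    where open ≡-Reasoning

  length-tuples : ∀ (xs : List A) ℓ → length (tuples xs ℓ) ≡ length xs ^ ℓ
  length-tuples xs zero    = refl
  length-tuples xs (suc ℓ) = trans (length-cpw xs) (cong (length xs *_) (length-tuples xs ℓ))
    where
    length-cpw : ∀ ys → length (cartesianProductWith _∷_ ys (tuples xs ℓ)) ≡ length ys * length (tuples xs ℓ)
    length-cpw []       = refl
    length-cpw (y ∷ ys) = trans (length-++ (map (y ∷_) (tuples xs ℓ))) (cong₂ _+_ (length-map (y ∷_) (tuples xs ℓ)) (length-cpw ys))

  _hasSize_inside_ : ∀ {n} → Subset n → ℕ → Subset n → Set
  S hasSize k inside I = S ⊆ I × ∣ S ∣ ≡ k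

  hasSize? : ∀ {n} (I : Subset n) k → Decidable (_hasSize k inside I)
  hasSize? I k S = (S ⊆? I) ×-dec (∣ S ∣ ≟ k)

  ∑-outside : ∀ {n} x (I : Subset n) k →
              ∑ (subsets n) (λ S → 𝟙 (hasSize? (x ∷ᵛ I) k (outside ∷ᵛ S))) ≡
              ∑ (subsets n) (λ S → 𝟙 (hasSize? I k S))
  ∑-outside x I k = ∑-cong (subsets _) λ S →
    𝟙-cong (hasSize? (x ∷ᵛ I) k (outside ∷ᵛ S)) (hasSize? I k S)
      (λ (S⊆I , ∣S∣≡k) → drop-∷-⊆ S⊆I , ∣S∣≡k)
      (λ (S⊆I , ∣S∣≡k) → out⊆ S⊆I , ∣S∣≡k)

  ∑-inside : ∀ {n} (I : Subset n) k →
             ∑ (subsets n) (λ S → 𝟙 (hasSize? (inside ∷ᵛ I) (suc k) (inside ∷ᵛ S))) ≡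
             ∑ (subsets n) (λ S → 𝟙 (hasSize? I k S))
  ∑-inside I k = ∑-cong (subsets _) λ S →
    𝟙-cong (hasSize? (inside ∷ᵛ I) (suc k) (inside ∷ᵛ S)) (hasSize? I k S)
      (λ (S⊆I , ∣S∣≡k) → drop-∷-⊆ S⊆I , suc-injective ∣S∣≡k)
      (λ (S⊆I , ∣S∣≡k) → s⊆s S⊆I , cong suc ∣S∣≡k)

  ∑-empty : ∀ {P : Pred A 0ℓ} (P? : Decidable P) xs → (∀ x → ¬ P x) → ∑ xs (λ x → 𝟙 (P? x)) ≡ 0
  ∑-empty P? xs ¬P = begin
    ∑ xs (λ x → 𝟙 (P? x))  ≡⟨ ∑-cong xs (λ x → 𝟙-no (P? x) (¬P x)) ⟩
    ∑ xs (λ _ → 0)         ≡⟨ ∑-const xs 0 ⟩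
    length xs * 0          ≡⟨ *-zeroʳ (length xs) ⟩
    0                      ∎
    where open ≡-Reasoning

  ∑-subsets : ∀ {n} (I : Subset n) k → ∑ (subsets n) (λ S → 𝟙 (hasSize? I k S)) ≡ ∣ I ∣ C k
  ∑-subsets []ᵛ zero    = refl
  ∑-subsets []ᵛ (suc k) = refl
  ∑-subsets {suc n} (x ∷ᵛ I) k = begin
    ∑ (map (inside ∷ᵛ_) (subsets n) ++ map (outside ∷ᵛ_) (subsets n)) F
      ≡⟨ ∑-++ (map (inside ∷ᵛ_) (subsets n)) _ F ⟩
    ∑ (map (inside ∷ᵛ_) (subsets n)) F + ∑ (map (outside ∷ᵛ_) (subsets n)) F
      ≡⟨ cong₂ _+_ (∑-map (inside ∷ᵛ_) (subsets n) F) (∑-map (outside ∷ᵛ_) (subsets n) F) ⟩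
    ∑ (subsets n) (F ∘ (inside ∷ᵛ_)) + ∑ (subsets n) (F ∘ (outside ∷ᵛ_))
      ≡⟨ cong (∑ (subsets n) (F ∘ (inside ∷ᵛ_)) +_) (trans (∑-outside x I k) (∑-subsets I k)) ⟩
    ∑ (subsets n) (F ∘ (inside ∷ᵛ_)) + ∣ I ∣ C k
      ≡⟨ pascal x k ⟩
    ∣ x ∷ᵛ I ∣ C k ∎
    where
    open ≡-Reasoning
    F : Subset (suc n) → ℕ
    F S = 𝟙 (hasSize? (x ∷ᵛ I) k S)

    pascal : ∀ x k → ∑ (subsets n) (λ S → 𝟙 (hasSize? (x ∷ᵛ I) k (inside ∷ᵛ S))) + ∣ I ∣ C k ≡ ∣ x ∷ᵛ I ∣ C k
    pascal outside k = cong (_+ ∣ I ∣ C k)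
      (∑-empty (λ S → hasSize? (outside ∷ᵛ I) k (inside ∷ᵛ S)) (subsets n) λ S (S⊆I , _) → zero∉ (S⊆I hereᵛ))
      where
      zero∉ : ¬ zero ∈ (outside ∷ᵛ I)
      zero∉ ()
    pascal inside zero = cong (_+ 1)
      (∑-empty (λ S → hasSize? (inside ∷ᵛ I) 0 (inside ∷ᵛ S)) (subsets n) λ { S (_ , ()) })
    pascal inside (suc k) = begin
      ∑ (subsets n) (λ S → 𝟙 (hasSize? (inside ∷ᵛ I) (suc k) (inside ∷ᵛ S))) + ∣ I ∣ C suc k
        ≡⟨ cong (_+ ∣ I ∣ C suc k) (trans (∑-inside I k) (∑-subsets I k)) ⟩
      ∣ I ∣ C k + ∣ I ∣ C suc k
        ≡⟨ nCk+nC[k+1]≡[n+1]C[k+1] ∣ I ∣ k ⟩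
      suc ∣ I ∣ C suc k ∎

  -- Median orders

  _∈?[_,_⟩ : ∀ x lo hi → Dec (lo ≤ x × x < hi)
  x ∈?[ lo , hi ⟩ = (lo ≤? x) ×-dec (x <? hi)

  𝟙-split : ∀ {lo mid hi} x → lo ≤ mid → mid ≤ hi →
            𝟙 (x ∈?[ lo , hi ⟩) ≡ 𝟙 (x ∈?[ lo , mid ⟩) + 𝟙 (x ∈?[ mid , hi ⟩)
  𝟙-split {lo} {mid} {hi} x lo≤mid mid≤hi with ≤-<-connex mid x
  ... | inj₁ mid≤x = trans
    (𝟙-cong (x ∈?[ lo , hi ⟩) (x ∈?[ mid , hi ⟩) (λ (_ , h) → mid≤x , h) (λ (m , h) → ≤-trans lo≤mid m , h))
    (cong (_+ 𝟙 (x ∈?[ mid , hi ⟩)) (sym (𝟙-no (x ∈?[ lo , mid ⟩) (λ (_ , x<mid) → <⇒≱ x<mid mid≤x))))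
  ... | inj₂ x<mid = begin
    𝟙 (x ∈?[ lo , hi ⟩)
      ≡⟨ 𝟙-cong (x ∈?[ lo , hi ⟩) (x ∈?[ lo , mid ⟩) (λ (l , _) → l , x<mid) (λ (l , _) → l , <-≤-trans x<mid mid≤hi) ⟩
    𝟙 (x ∈?[ lo , mid ⟩)
      ≡⟨ +-identityʳ _ ⟨
    𝟙 (x ∈?[ lo , mid ⟩) + 0
      ≡⟨ cong (𝟙 (x ∈?[ lo , mid ⟩) +_) (𝟙-no (x ∈?[ mid , hi ⟩) (λ (m , _) → <⇒≱ x<mid m)) ⟨
    𝟙 (x ∈?[ lo , mid ⟩) + 𝟙 (x ∈?[ mid , hi ⟩) ∎
    where open ≡-Reasoning

  ∑-split : ∀ {A : Set} (xs : List A) (g h : A → ℕ) {lo mid hi} → lo ≤ mid → mid ≤ hi →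
            ∑ xs (λ x → 𝟙 (g x ∈?[ lo , hi ⟩) * h x) ≡
            ∑ xs (λ x → 𝟙 (g x ∈?[ lo , mid ⟩) * h x) + ∑ xs (λ x → 𝟙 (g x ∈?[ mid , hi ⟩) * h x)
  ∑-split xs g h {lo} {mid} {hi} lo≤mid mid≤hi = trans
    (∑-cong xs λ x → trans (cong (_* h x) (𝟙-split (g x) lo≤mid mid≤hi))
                           (*-distribʳ-+ (h x) (𝟙 (g x ∈?[ lo , mid ⟩)) (𝟙 (g x ∈?[ mid , hi ⟩))))
    (∑-distrib-+ xs _ _)

  ∑-interval : ∀ {n} lo {hi} → lo ≤ hi → hi ≤ n →
               ∑ (allFin n) (λ x → 𝟙 (toℕ x ∈?[ lo , hi ⟩)) ≡ hi ∸ lo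
  ∑-interval {zero} lo {zero} lo≤hi hi≤n = sym (0∸n≡0 lo)
  ∑-interval {suc n} lo {zero} lo≤hi hi≤n = trans
    (∑-empty (λ x → toℕ x ∈?[ lo , 0 ⟩) (allFin (suc n)) λ _ ()) (sym (0∸n≡0 lo))
  ∑-interval {suc n} zero {suc hi} lo≤hi (s≤s hi≤n) = trans (∑-suc (λ (x : Fin (suc n)) → 𝟙 (toℕ x ∈?[ 0 , suc hi ⟩)))
    (cong suc (trans (∑-cong (allFin n) λ x →
        𝟙-cong (suc (toℕ x) ∈?[ 0 , suc hi ⟩) (toℕ x ∈?[ 0 , hi ⟩)
          (λ (_ , h) → z≤n , s≤s⁻¹ h) (λ (_ , h) → z≤n , s≤s h))
      (∑-interval 0 z≤n hi≤n)))
  ∑-interval {suc n} (suc lo) {suc hi} (s≤s lo≤hi) (s≤s hi≤n) = trans (∑-suc (λ (x : Fin (suc n)) → 𝟙 (toℕ x ∈?[ suc lo , suc hi ⟩)))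
    (trans (∑-cong (allFin n) λ x →
        𝟙-cong (suc (toℕ x) ∈?[ suc lo , suc hi ⟩) (toℕ x ∈?[ lo , hi ⟩)
          (λ (l , h) → s≤s⁻¹ l , s≤s⁻¹ h) (λ (l , h) → s≤s l , s≤s h))
      (∑-interval lo lo≤hi hi≤n))

  𝟙-<-punchIn : ∀ {n} (i : Fin (suc n)) x → 𝟙 (i <ᶠ? punchIn i x) ≡ 𝟙 (toℕ i ≤? toℕ x)
  𝟙-<-punchIn i x = 𝟙-cong (i <ᶠ? punchIn i x) (toℕ i ≤? toℕ x) (to i x) (from i x)
    where
    to : ∀ {n} (i : Fin (suc n)) x → i Fin.< punchIn i x → toℕ i ≤ toℕ x
    to zero    x       _         = z≤n
    to (suc i) (suc x) (s≤s i<x) = s≤s (to i x i<x)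
    from : ∀ {n} (i : Fin (suc n)) x → toℕ i ≤ toℕ x → i Fin.< punchIn i x
    from zero    x       _         = z<s
    from (suc i) (suc x) (s≤s i≤x) = s≤s (from i x i≤x)

  𝟙-punchIn-< : ∀ {n} (i : Fin (suc n)) x → 𝟙 (punchIn i x <ᶠ? i) ≡ 𝟙 (toℕ x ∈?[ 0 , toℕ i ⟩)
  𝟙-punchIn-< i x = 𝟙-cong (punchIn i x <ᶠ? i) (toℕ x ∈?[ 0 , toℕ i ⟩) (λ lt → z≤n , to i x lt) (from i x ∘ proj₂)
    where
    to : ∀ {n} (i : Fin (suc n)) x → punchIn i x Fin.< i → toℕ x < toℕ i
    to (suc i) zero    _         = z<s
    to (suc i) (suc x) (s≤s x<i) = s≤s (to i x x<i)
    from : ∀ {n} (i : Fin (suc n)) x → toℕ x < toℕ i → punchIn i x Fin.< i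
    from (suc i) zero    _         = z<s
    from (suc i) (suc x) (s≤s x<i) = s≤s (from i x x<i)

  toℕ-punchIn-< : ∀ {n} (i : Fin (suc n)) x → toℕ x < toℕ i → toℕ (punchIn i x) ≡ toℕ x
  toℕ-punchIn-< (suc i) zero    _         = refl
  toℕ-punchIn-< (suc i) (suc x) (s≤s x<i) = cong suc (toℕ-punchIn-< i x x<i)

  punchIn-<-cong : ∀ {n} (i : Fin (suc n)) x y → 𝟙 (punchIn i x <ᶠ? punchIn i y) ≡ 𝟙 (x <ᶠ? y)
  punchIn-<-cong i x y = 𝟙-cong (punchIn i x <ᶠ? punchIn i y) (x <ᶠ? y)
    (λ lt → ≰⇒> (<⇒≱ lt ∘ punchIn-mono-≤ i y x))
    (λ lt → ≰⇒> (<⇒≱ lt ∘ punchIn-cancel-≤ i y x))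

  module _ {N : ℕ} (T : Tournament N) where
    open Tournament T

    forwardEdges≡∑ : ∀ σ → forwardEdges T σ ≡
      ∑ (allFin N) (λ x → ∑ (allFin N) (λ y → 𝟙 (x <ᶠ? y) * 𝟙 ((σ ⟨$⟩ʳ x) ⟶? (σ ⟨$⟩ʳ y))))
    forwardEdges≡∑ σ = begin
      forwardEdges T σ
        ≡⟨ length-filter _ (cartesianProduct (allFin N) (allFin N)) ⟩
      _ ≡⟨ ∑-cartesianProductWith _,_ (allFin N) (allFin N) _ ⟩
      _ ≡⟨ ∑-cong (allFin N) (λ x → ∑-cong (allFin N) (λ y → 𝟙-× (x <ᶠ? y) ((σ ⟨$⟩ʳ x) ⟶? (σ ⟨$⟩ʳ y)))) ⟩
      _ ∎
      where open ≡-Reasoning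

    ⟶-complement : ∀ {u v} → u ≢ v → 𝟙 (u ⟶? v) + 𝟙 (v ⟶? u) ≡ 1
    ⟶-complement {u} {v} u≢v with compare u v
    ... | tri< u⟶v _ ¬v⟶u = cong₂ _+_ (𝟙-yes (yes u⟶v) u⟶v) (𝟙-no (v ⟶? u) ¬v⟶u)
    ... | tri≈ _ u≡v _     = contradiction u≡v u≢v
    ... | tri> ¬u⟶v _ v⟶u = 𝟙-yes (v ⟶? u) v⟶u

  module _ {n : ℕ} (T : Tournament (suc n)) where
    open Tournament T

    forwardEdges-pivot : ∀ ρ i t (r : Fin n → Fin (suc n)) →
      ρ ⟨$⟩ʳ i ≡ t → (∀ x → ρ ⟨$⟩ʳ punchIn i x ≡ r x) →
      forwardEdges T ρ ≡
        ∑ (allFin n) (λ y → 𝟙 (toℕ i ≤? toℕ y) * 𝟙 (t ⟶? r y)) +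
        (∑ (allFin n) (λ x → 𝟙 (toℕ x ∈?[ 0 , toℕ i ⟩) * 𝟙 (r x ⟶? t)) +
         ∑ (allFin n) (λ x → ∑ (allFin n) (λ y → 𝟙 (x <ᶠ? y) * 𝟙 (r x ⟶? r y))))
    forwardEdges-pivot ρ i t r ρi≡t ρ≡r = trans (forwardEdges≡∑ T ρ) (trans (∑-∑-punchIn i F) (cong₂ _+_
      (cong₂ _+_ (cong (_* 𝟙 ((ρ ⟨$⟩ʳ i) ⟶? (ρ ⟨$⟩ʳ i))) (𝟙-no (i <ᶠ? i) (n≮n (toℕ i))))
        (∑-cong (allFin n) λ y → cong₂ _*_ (𝟙-<-punchIn i y) (cong₂ e ρi≡t (ρ≡r y))))
      (cong₂ _+_ (∑-cong (allFin n) λ x → cong₂ _*_ (𝟙-punchIn-< i x) (cong₂ e (ρ≡r x) ρi≡t))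
        (∑-cong (allFin n) λ x → ∑-cong (allFin n) λ y →
          cong₂ _*_ (punchIn-<-cong i x y) (cong₂ e (ρ≡r x) (ρ≡r y))))))
      where
      e : Fin (suc n) → Fin (suc n) → ℕ
      e u v = 𝟙 (u ⟶? v)
      F : Fin (suc n) → Fin (suc n) → ℕ
      F x y = 𝟙 (x <ᶠ? y) * e (ρ ⟨$⟩ʳ x) (ρ ⟨$⟩ʳ y)

    module _ (σ : Ordering) (median : IsMedianOrder T σ) where

      -- Moving the vertex at position p forward to position i gives another
      -- ordering, whose forward edges differ only in those at the moved vertex.
      median-positions : ∀ (i p : Fin (suc n)) → toℕ i ≤ toℕ p →
        toℕ p ∸ toℕ i ≤ 2 * ∑ (allFin (suc n)) (λ x →
          𝟙 (toℕ x ∈?[ toℕ i , toℕ p ⟩) * 𝟙 ((σ ⟨$⟩ʳ x) ⟶? (σ ⟨$⟩ʳ p)))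
      median-positions i p i≤p = begin
        toℕ p ∸ toℕ i
          ≡⟨ ∑-interval (toℕ i) i≤p (s≤s⁻¹ (toℕ<n p)) ⟨
        ∑ (allFin n) (λ y → 𝟙 (toℕ y ∈?[ toℕ i , toℕ p ⟩))
          ≡⟨ ∑-cong (allFin n) (λ y → trans (sym (*-identityʳ _))
               (trans (cong (𝟙 (toℕ y ∈?[ toℕ i , toℕ p ⟩) *_) (sym (⟶-complement T (t≢r y))))
                 (*-distribˡ-+ (𝟙 (toℕ y ∈?[ toℕ i , toℕ p ⟩)) _ _))) ⟩
        ∑ (allFin n) (λ y → 𝟙 (toℕ y ∈?[ toℕ i , toℕ p ⟩) * out y + 𝟙 (toℕ y ∈?[ toℕ i , toℕ p ⟩) * inn y)
          ≡⟨ ∑-distrib-+ (allFin n) _ _ ⟩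
        Out + In
          ≤⟨ +-monoˡ-≤ In Out≤In ⟩
        In + In
          ≡⟨ cong (In +_) (+-identityʳ In) ⟨
        2 * In
          ≤⟨ *-monoʳ-≤ 2 (∑-mono (allFin n) λ y → *-monoˡ-≤ (inn y)
               (𝟙-mono (toℕ y ∈?[ toℕ i , toℕ p ⟩) (toℕ (punchIn p y) ∈?[ toℕ i , toℕ p ⟩)
                 λ (l , h) → subst (λ x → toℕ i ≤ x × x < toℕ p) (sym (toℕ-punchIn-< p y h)) (l , h))) ⟩
        2 * ∑ (allFin n) (G ∘ punchIn p)
          ≤⟨ *-monoʳ-≤ 2 (m≤n+m _ (G p)) ⟩
        2 * (G p + ∑ (allFin n) (G ∘ punchIn p))
          ≡⟨ cong (2 *_) (∑-punchIn p G) ⟨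
        2 * ∑ (allFin (suc n)) G ∎
        where
        open ≤-Reasoning
        t : Fin (suc n)
        t = σ ⟨$⟩ʳ p
        r : Fin n → Fin (suc n)
        r x = σ ⟨$⟩ʳ punchIn p x
        t≢r : ∀ x → t ≢ r x
        t≢r x t≡r = punchInᵢ≢i p x (sym (trans (sym (inverseˡ σ)) (trans (cong (σ ⟨$⟩ˡ_) t≡r) (inverseˡ σ))))
        out inn : Fin n → ℕ
        out y = 𝟙 (t ⟶? r y)
        inn y = 𝟙 (r y ⟶? t)
        G : Fin (suc n) → ℕ
        G x = 𝟙 (toℕ x ∈?[ toℕ i , toℕ p ⟩) * 𝟙 ((σ ⟨$⟩ʳ x) ⟶? t)
        Out In R : ℕ
        Out = ∑ (allFin n) (λ y → 𝟙 (toℕ y ∈?[ toℕ i , toℕ p ⟩) * out y)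
        In = ∑ (allFin n) (λ y → 𝟙 (toℕ y ∈?[ toℕ i , toℕ p ⟩) * inn y)
        R = ∑ (allFin n) (λ x → ∑ (allFin n) (λ y → 𝟙 (x <ᶠ? y) * 𝟙 (r x ⟶? r y)))

        above before : ℕ → ℕ
        above m = ∑ (allFin n) (λ y → 𝟙 (m ≤? toℕ y) * out y)
        before m = ∑ (allFin n) (λ y → 𝟙 (toℕ y ∈?[ 0 , m ⟩) * inn y)

        τ : Ordering
        τ = insert i p Perm.id ∘ₚ σ

        insert-i : insert i p Perm.id ⟨$⟩ʳ i ≡ p
        insert-i with i ≟ᶠ i
        ... | yes _  = refl
        ... | no i≢i = contradiction refl i≢i

        ≤?-≡ : ∀ m → m ≤ n → ∀ y → 𝟙 (m ≤? toℕ {n} y) ≡ 𝟙 (toℕ y ∈?[ m , n ⟩)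
        ≤?-≡ m m≤n y = 𝟙-cong (m ≤? toℕ y) (toℕ y ∈?[ m , n ⟩) (λ l → l , toℕ<n y) proj₁

        above-split : above (toℕ i) ≡ Out + above (toℕ p)
        above-split = begin-equality
          above (toℕ i)
            ≡⟨ ∑-cong (allFin n) (λ y → cong (_* out y) (≤?-≡ (toℕ i) (≤-trans i≤p p≤n) y)) ⟩
          ∑ (allFin n) (λ y → 𝟙 (toℕ y ∈?[ toℕ i , n ⟩) * out y)
            ≡⟨ ∑-split (allFin n) toℕ out i≤p p≤n ⟩
          Out + ∑ (allFin n) (λ y → 𝟙 (toℕ y ∈?[ toℕ p , n ⟩) * out y)
            ≡⟨ cong (Out +_) (∑-cong (allFin n) (λ y → cong (_* out y) (≤?-≡ (toℕ p) p≤n y))) ⟨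
          Out + above (toℕ p) ∎
          where
          p≤n : toℕ p ≤ n
          p≤n = s≤s⁻¹ (toℕ<n p)

        before-split : before (toℕ p) ≡ before (toℕ i) + In
        before-split = ∑-split (allFin n) toℕ inn z≤n i≤p

        rearrange₁ : ∀ o u v w → o + u + (v + w) ≡ o + (u + (v + w))
        rearrange₁ = solve-∀
        rearrange₂ : ∀ u v o w → u + (v + o + w) ≡ o + (u + (v + w))
        rearrange₂ = solve-∀

        Out≤In : Out ≤ In
        Out≤In = +-cancelʳ-≤ (above (toℕ p) + (before (toℕ i) + R)) Out In (begin
          Out + (above (toℕ p) + (before (toℕ i) + R))
            ≡⟨ rearrange₁ Out _ _ R ⟨
          Out + above (toℕ p) + (before (toℕ i) + R)
            ≡⟨ cong (_+ (before (toℕ i) + R)) above-split ⟨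
          above (toℕ i) + (before (toℕ i) + R)
            ≡⟨ forwardEdges-pivot τ i t r (cong (σ ⟨$⟩ʳ_) insert-i)
                 (λ x → cong (σ ⟨$⟩ʳ_) (insert-punchIn i p Perm.id x)) ⟨
          forwardEdges T τ
            ≤⟨ median τ ⟩
          forwardEdges T σ
            ≡⟨ forwardEdges-pivot σ p t r refl (λ _ → refl) ⟩
          above (toℕ p) + (before (toℕ p) + R)
            ≡⟨ cong (λ z → above (toℕ p) + (z + R)) before-split ⟩
          above (toℕ p) + (before (toℕ i) + In + R)
            ≡⟨ rearrange₂ (above (toℕ p)) _ In R ⟩
          In + (above (toℕ p) + (before (toℕ i) + R)) ∎)

  ∑-index : ∀ {N} (σ : Ordering {N}) (f : ℕ → Fin N → ℕ) →
            ∑ (allFin N) (λ v → f (index σ v) v) ≡ ∑ (allFin N) (λ x → f (suc (toℕ x)) (σ ⟨$⟩ʳ x))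
  ∑-index σ f = trans (∑-permute σ _)
    (∑-cong (allFin _) λ x → cong (λ y → f (suc (toℕ y)) (σ ⟨$⟩ʳ x)) (inverseˡ σ))

  ∑-index-interval : ∀ {N} (σ : Ordering {N}) {lo hi} → 1 ≤ lo → lo ≤ hi → hi ≤ suc N →
                     ∑ (allFin N) (λ v → 𝟙 (index σ v ∈?[ lo , hi ⟩)) ≡ hi ∸ lo
  ∑-index-interval {N} σ {suc lo} {suc hi} _ (s≤s lo≤hi) (s≤s hi≤N) = begin
    ∑ (allFin N) (λ v → 𝟙 (index σ v ∈?[ suc lo , suc hi ⟩))
      ≡⟨ ∑-index σ (λ x _ → 𝟙 (x ∈?[ suc lo , suc hi ⟩)) ⟩
    ∑ (allFin N) (λ x → 𝟙 (suc (toℕ x) ∈?[ suc lo , suc hi ⟩))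
      ≡⟨ ∑-cong (allFin N) (λ x → 𝟙-cong (suc (toℕ x) ∈?[ suc lo , suc hi ⟩) (toℕ x ∈?[ lo , hi ⟩)
          (λ (l , h) → s≤s⁻¹ l , s≤s⁻¹ h) (λ (l , h) → s≤s l , s≤s h)) ⟩
    ∑ (allFin N) (λ x → 𝟙 (toℕ x ∈?[ lo , hi ⟩))
      ≡⟨ ∑-interval lo lo≤hi hi≤N ⟩
    hi ∸ lo ∎
    where open ≡-Reasoning

  median-inNeighbours : ∀ {N} (T : Tournament N) σ → IsMedianOrder T σ → (let open Tournament T) →
    ∀ lo t → 1 ≤ lo → lo ≤ index σ t →
    index σ t ∸ lo ≤ 2 * ∑ (allFin N) (λ v → 𝟙 (index σ v ∈?[ lo , index σ t ⟩) * 𝟙 (v ⟶? t))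
  median-inNeighbours {suc n} T σ median (suc lo) t _ (s≤s lo≤p) = begin
    toℕ p ∸ lo
      ≡⟨ cong (toℕ p ∸_) toℕ-i ⟨
    toℕ p ∸ toℕ i
      ≤⟨ median-positions T σ median i p (≤-trans (≤-reflexive toℕ-i) lo≤p) ⟩
    2 * ∑ (allFin (suc n)) (λ x → 𝟙 (toℕ x ∈?[ toℕ i , toℕ p ⟩) * 𝟙 ((σ ⟨$⟩ʳ x) ⟶? (σ ⟨$⟩ʳ p)))
      ≡⟨ cong (2 *_) (∑-cong (allFin (suc n)) λ x → cong₂ _*_
           (𝟙-cong (toℕ x ∈?[ toℕ i , toℕ p ⟩) (suc (toℕ x) ∈?[ suc lo , suc (toℕ p) ⟩)
              (λ (l , h) → s≤s (subst (_≤ toℕ x) toℕ-i l) , s≤s h)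
              (λ (l , h) → subst (_≤ toℕ x) (sym toℕ-i) (s≤s⁻¹ l) , s≤s⁻¹ h))
           (cong (λ u → 𝟙 ((σ ⟨$⟩ʳ x) ⟶? u)) (inverseʳ σ))) ⟩
    2 * ∑ (allFin (suc n)) (λ x → 𝟙 (suc (toℕ x) ∈?[ suc lo , index σ t ⟩) * 𝟙 ((σ ⟨$⟩ʳ x) ⟶? t))
      ≡⟨ cong (2 *_) (∑-index σ (λ x v → 𝟙 (x ∈?[ suc lo , index σ t ⟩) * 𝟙 (v ⟶? t))) ⟨
    2 * ∑ (allFin (suc n)) (λ v → 𝟙 (index σ v ∈?[ suc lo , index σ t ⟩) * 𝟙 (v ⟶? t)) ∎
    where
    open ≤-Reasoning
    open Tournament T
    p i : Fin (suc n)
    p = σ ⟨$⟩ˡ t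
    lo<1+n : lo < suc n
    lo<1+n = ≤-<-trans lo≤p (toℕ<n p)
    i = fromℕ< lo<1+n
    toℕ-i : toℕ i ≡ lo
    toℕ-i = toℕ-fromℕ< lo<1+n

  -- Dependent random choice

  rearrangement : ∀ {x y u v} → x ≤ y → u ≤ v → x * v + y * u ≤ x * u + y * v
  rearrangement {x} {y} {u} {v} x≤y u≤v with m≤n⇒∃[o]m+o≡n x≤y | m≤n⇒∃[o]m+o≡n u≤v
  ... | d , refl | e , refl = subst (x * (u + e) + (x + d) * u ≤_) (identity x u d e) (m≤m+n _ (d * e))
    where
    identity : ∀ x u d e → x * (u + e) + (x + d) * u + d * e ≡ x * u + (x + d) * (u + e)
    identity = solve-∀

  power-rearrangement : ∀ p x y → y * x ^ p + y ^ p * x ≤ x ^ suc p + y ^ suc p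
  power-rearrangement p x y with ≤-total x y
  ... | inj₁ x≤y = begin
    y * x ^ p + y ^ p * x  ≡⟨ +-comm (y * x ^ p) (y ^ p * x) ⟩
    y ^ p * x + y * x ^ p  ≡⟨ cong (_+ y * x ^ p) (*-comm (y ^ p) x) ⟩
    x * y ^ p + y * x ^ p  ≤⟨ rearrangement x≤y (^-monoˡ-≤ p x≤y) ⟩
    x ^ suc p + y ^ suc p  ∎
    where open ≤-Reasoning
  ... | inj₂ y≤x = begin
    y * x ^ p + y ^ p * x  ≡⟨ cong (y * x ^ p +_) (*-comm (y ^ p) x) ⟩
    y * x ^ p + x * y ^ p  ≤⟨ rearrangement y≤x (^-monoˡ-≤ p y≤x) ⟩
    y ^ suc p + x ^ suc p  ≡⟨ +-comm (y ^ suc p) (x ^ suc p) ⟩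
    x ^ suc p + y ^ suc p  ∎
    where open ≤-Reasoning

  -- The tangent line to z ↦ zᵖ⁺¹ at y lies below the graph at x; the term
  -- p yᵖ⁺¹ is moved to the right so that no subtraction occurs.
  tangent : ∀ p x y → suc p * (y ^ p * x) ≤ x ^ suc p + p * y ^ suc p
  tangent zero    x y = ≤-reflexive (identity x)
    where
    identity : ∀ x → 1 * (1 * x) ≡ x * 1 + 0
    identity = solve-∀
  tangent (suc p) x y = begin
    suc (suc p) * (y ^ suc p * x)
      ≡⟨ identity₁ p x y (y ^ p) ⟩
    y * (suc p * (y ^ p * x)) + y ^ suc p * x
      ≤⟨ +-monoˡ-≤ (y ^ suc p * x) (*-monoʳ-≤ y (tangent p x y)) ⟩
    y * (x ^ suc p + p * y ^ suc p) + y ^ suc p * x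
      ≡⟨ identity₂ p x y (x ^ p) (y ^ p) ⟩
    y * x ^ suc p + y ^ suc p * x + p * y ^ suc (suc p)
      ≤⟨ +-monoˡ-≤ (p * y ^ suc (suc p)) (power-rearrangement (suc p) x y) ⟩
    x ^ suc (suc p) + y ^ suc (suc p) + p * y ^ suc (suc p)
      ≡⟨ +-assoc (x ^ suc (suc p)) _ _ ⟩
    x ^ suc (suc p) + suc p * y ^ suc (suc p) ∎
    where
    open ≤-Reasoning
    identity₁ : ∀ p x y Y → (1 + (1 + p)) * (y * Y * x) ≡ y * ((1 + p) * (Y * x)) + y * Y * x
    identity₁ = solve-∀
    identity₂ : ∀ p x y X Y → y * (x * X + p * (y * Y)) + y * Y * x ≡ y * (x * X) + y * Y * x + p * (y * (y * Y))
    identity₂ = solve-∀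

  power-mean : ∀ {A : Set} (xs : List A) (f : A → ℕ) y p → length xs * y ≤ ∑ xs f →
               length xs * y ^ suc p ≤ ∑ xs (λ x → f x ^ suc p)
  power-mean xs f y p L*y≤∑f = +-cancelʳ-≤ (L * (p * y ^ suc p)) _ _ (begin
    L * y ^ suc p + L * (p * y ^ suc p)
      ≡⟨ identity L p y (y ^ p) ⟩
    suc p * y ^ p * (L * y)
      ≤⟨ *-monoʳ-≤ (suc p * y ^ p) L*y≤∑f ⟩
    suc p * y ^ p * ∑ xs f
      ≡⟨ *-distribˡ-∑ (suc p * y ^ p) xs f ⟩
    ∑ xs (λ x → suc p * y ^ p * f x)
      ≡⟨ ∑-cong xs (λ x → *-assoc (suc p) (y ^ p) (f x)) ⟩
    ∑ xs (λ x → suc p * (y ^ p * f x))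
      ≤⟨ ∑-mono xs (λ x → tangent p (f x) y) ⟩
    ∑ xs (λ x → f x ^ suc p + p * y ^ suc p)
      ≡⟨ ∑-distrib-+ xs (λ x → f x ^ suc p) (λ _ → p * y ^ suc p) ⟩
    ∑ xs (λ x → f x ^ suc p) + ∑ xs (λ _ → p * y ^ suc p)
      ≡⟨ cong (∑ xs (λ x → f x ^ suc p) +_) (∑-const xs _) ⟩
    ∑ xs (λ x → f x ^ suc p) + L * (p * y ^ suc p) ∎)
    where
    open ≤-Reasoning
    L : ℕ
    L = length xs
    identity : ∀ L p y Y → L * (y * Y) + L * (p * (y * Y)) ≡ (1 + p) * Y * (L * y)
    identity = solve-∀

  blocks : (width lo m : ℕ) → List ℕ
  blocks w lo zero    = []
  blocks w lo (suc m) = lo ∷ blocks w (lo + w) m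

  length-blocks : ∀ w lo m → length (blocks w lo m) ≡ m
  length-blocks w lo zero    = refl
  length-blocks w lo (suc m) = cong suc (length-blocks w (lo + w) m)

  ∈-blocks : ∀ w {lo} m {c} → c ∈ˡ blocks w lo m → lo ≤ c × c + w ≤ lo + m * w
  ∈-blocks w {lo} (suc m) (here refl) = ≤-refl , +-monoʳ-≤ lo (m≤m+n w (m * w))
  ∈-blocks w {lo} (suc m) {c} (there c∈) = let lo+w≤c , c+w≤ = ∈-blocks w m c∈ in
    ≤-trans (m≤m+n lo w) lo+w≤c , subst (c + w ≤_) (+-assoc lo w (m * w)) c+w≤

  ∑-blocks : ∀ w lo m x → ∑ (blocks w lo m) (λ c → 𝟙 (x ∈?[ c , c + w ⟩)) ≡ 𝟙 (x ∈?[ lo , lo + m * w ⟩)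
  ∑-blocks w lo zero    x = sym (𝟙-no (x ∈?[ lo , lo + 0 ⟩)
    (λ (l , h) → <⇒≱ h (≤-trans (≤-reflexive (+-identityʳ lo)) l)))
  ∑-blocks w lo (suc m) x = begin
    𝟙 (x ∈?[ lo , lo + w ⟩) + ∑ (blocks w (lo + w) m) (λ c → 𝟙 (x ∈?[ c , c + w ⟩))
      ≡⟨ cong (𝟙 (x ∈?[ lo , lo + w ⟩) +_) (∑-blocks w (lo + w) m x) ⟩
    𝟙 (x ∈?[ lo , lo + w ⟩) + 𝟙 (x ∈?[ lo + w , lo + w + m * w ⟩)
      ≡⟨ 𝟙-split x (m≤m+n lo w) (m≤m+n (lo + w) (m * w)) ⟨
    𝟙 (x ∈?[ lo , lo + w + m * w ⟩)
      ≡⟨ cong (λ h → 𝟙 (x ∈?[ lo , h ⟩)) (+-assoc lo w (m * w)) ⟩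
    𝟙 (x ∈?[ lo , lo + (w + m * w) ⟩) ∎
    where open ≡-Reasoning

  module _ {N : ℕ} (T : Tournament N) (σ : Ordering {N}) where
    open Tournament T

    module _ (median : IsMedianOrder T σ) where

      median-inNeighbours-window : ∀ K w lo t → 1 ≤ lo →
        lo + 2 * suc K * w ≤ index σ t → index σ t < lo + 2 * suc K * w + 2 * w →
        K * w ≤ ∑ (allFin N) (λ v → 𝟙 (index σ v ∈?[ lo , lo + 2 * suc K * w ⟩) * 𝟙 (v ⟶? t))
      median-inNeighbours-window K w lo t 1≤lo j≤t t<j+2w = *-cancelˡ-≤ 2 (+-cancelʳ-≤ (2 * w) _ _ (+-cancelʳ-≤ r _ _ (begin
        2 * (K * w) + 2 * w + r
          ≡⟨ identity₁ K w r ⟩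
        2 * suc K * w + r
          ≡⟨ m+n∸m≡n lo (2 * suc K * w + r) ⟨
        lo + (2 * suc K * w + r) ∸ lo
          ≡⟨ cong (_∸ lo) (trans (sym (+-assoc lo (2 * suc K * w) r)) (m+[n∸m]≡n j≤t)) ⟩
        index σ t ∸ lo
          ≤⟨ median-inNeighbours T σ median lo t 1≤lo (≤-trans lo≤j j≤t) ⟩
        2 * inDegree lo (index σ t)
          ≡⟨ cong (2 *_) (∑-split (allFin N) (index σ) (λ v → 𝟙 (v ⟶? t)) lo≤j j≤t) ⟩
        2 * (inDegree lo j + inDegree j (index σ t))
          ≤⟨ *-monoʳ-≤ 2 (+-monoʳ-≤ (inDegree lo j) (∑-mono (allFin N) λ v →
               ≤-trans (*-monoʳ-≤ (𝟙 (index σ v ∈?[ j , index σ t ⟩)) (𝟙≤1 (v ⟶? t))) (≤-reflexive (*-identityʳ _)))) ⟩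
        2 * (inDegree lo j + ∑ (allFin N) (λ v → 𝟙 (index σ v ∈?[ j , index σ t ⟩)))
          ≡⟨ cong (λ z → 2 * (inDegree lo j + z))
               (∑-index-interval σ (≤-trans 1≤lo lo≤j) j≤t (≤-trans (toℕ<n (σ ⟨$⟩ˡ t)) (n≤1+n N))) ⟩
        2 * (inDegree lo j + r)
          ≡⟨ identity₂ (inDegree lo j) r ⟩
        2 * inDegree lo j + r + r
          ≤⟨ +-monoˡ-≤ r (+-monoʳ-≤ (2 * inDegree lo j) r≤2w) ⟩
        2 * inDegree lo j + 2 * w + r ∎)))
        where
        open ≤-Reasoning
        j r : ℕ
        j = lo + 2 * suc K * w
        r = index σ t ∸ j
        lo≤j : lo ≤ j
        lo≤j = m≤m+n lo _
        inDegree : ℕ → ℕ → ℕ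
        inDegree l h = ∑ (allFin N) (λ v → 𝟙 (index σ v ∈?[ l , h ⟩) * 𝟙 (v ⟶? t))
        r≤2w : r ≤ 2 * w
        r≤2w = ≤-trans (∸-monoˡ-≤ j (<⇒≤ t<j+2w)) (≤-reflexive (m+n∸m≡n j (2 * w)))
        identity₁ : ∀ K w r → 2 * (K * w) + 2 * w + r ≡ 2 * (1 + K) * w + r
        identity₁ = solve-∀
        identity₂ : ∀ D r → 2 * (D + r) ≡ 2 * D + r + r
        identity₂ = solve-∀

    commonInNeighbours : (w c : ℕ) → List (Fin N) → Subset N
    commonInNeighbours w c ts = ⟦ (λ v → (index σ v ∈?[ c , c + w ⟩) ×-dec all? (v ⟶?_) ts) ⟧

    ∣interval∣ : ∀ {c w} → 1 ≤ c → c + w ≤ suc N → ∣ interval σ c (c + w) ∣ ≡ w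
    ∣interval∣ {c} {w} 1≤c c+w≤1+N = trans (∣⟦⟧∣ (λ v → index σ v ∈?[ c , c + w ⟩))
      (trans (∑-index-interval σ 1≤c (m≤m+n c w) c+w≤1+N) (m+n∸m≡n c w))

    commonInNeighbours⊆interval : ∀ w c ts → commonInNeighbours w c ts ⊆ interval σ c (c + w)
    commonInNeighbours⊆interval w c ts v∈A =
      ∈⟦⟧⁺ (λ v → index σ v ∈?[ c , c + w ⟩)
        (proj₁ (∈⟦⟧⁻ (λ v → (index σ v ∈?[ c , c + w ⟩) ×-dec all? (v ⟶?_) ts) v∈A))

    module _ (B : Subset N) where

      vertices : List (Fin N)
      vertices = filter (_∈? B) (allFin N)

      length-vertices : length vertices ≡ ∣ B ∣
      length-vertices = trans (length-filter (_∈? B) (allFin N)) (sym (∣p∣≡∑ B))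

      outDegree : Fin N → ℕ
      outDegree v = ∑ vertices (λ t → 𝟙 (v ⟶? t))

      ∑-∣commonInNeighbours∣ : ∀ w lo m ℓ →
        ∑ (blocks w lo m) (λ c → ∑ (tuples vertices ℓ) (λ ts → ∣ commonInNeighbours w c ts ∣)) ≡
        ∑ (allFin N) (λ v → 𝟙 (index σ v ∈?[ lo , lo + m * w ⟩) * outDegree v ^ ℓ)
      ∑-∣commonInNeighbours∣ w lo m ℓ = begin
        ∑ Cs (λ c → ∑ Ts (λ ts → ∣ commonInNeighbours w c ts ∣))
          ≡⟨ ∑-cong Cs (λ c → ∑-cong Ts (λ ts → trans
               (∣⟦⟧∣ (λ v → (index σ v ∈?[ c , c + w ⟩) ×-dec all? (v ⟶?_) ts))
               (∑-cong (allFin N) (λ v → 𝟙-× (index σ v ∈?[ c , c + w ⟩) (all? (v ⟶?_) ts))))) ⟩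
        ∑ Cs (λ c → ∑ Ts (λ ts → ∑ (allFin N) (λ v → 𝟙 (index σ v ∈?[ c , c + w ⟩) * 𝟙 (all? (v ⟶?_) ts))))
          ≡⟨ ∑-cong Cs (λ c → ∑-comm Ts (allFin N) _) ⟩
        ∑ Cs (λ c → ∑ (allFin N) (λ v → ∑ Ts (λ ts → 𝟙 (index σ v ∈?[ c , c + w ⟩) * 𝟙 (all? (v ⟶?_) ts))))
          ≡⟨ ∑-cong Cs (λ c → ∑-cong (allFin N) (λ v → trans
               (sym (*-distribˡ-∑ (𝟙 (index σ v ∈?[ c , c + w ⟩)) Ts _))
               (cong (𝟙 (index σ v ∈?[ c , c + w ⟩) *_) (∑-tuples (v ⟶?_) vertices ℓ)))) ⟩
        ∑ Cs (λ c → ∑ (allFin N) (λ v → 𝟙 (index σ v ∈?[ c , c + w ⟩) * outDegree v ^ ℓ))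
          ≡⟨ ∑-comm Cs (allFin N) _ ⟩
        ∑ (allFin N) (λ v → ∑ Cs (λ c → 𝟙 (index σ v ∈?[ c , c + w ⟩) * outDegree v ^ ℓ))
          ≡⟨ ∑-cong (allFin N) (λ v → trans
               (sym (*-distribʳ-∑ (outDegree v ^ ℓ) Cs _))
               (cong (_* outDegree v ^ ℓ) (∑-blocks w lo m (index σ v)))) ⟩
        ∑ (allFin N) (λ v → 𝟙 (index σ v ∈?[ lo , lo + m * w ⟩) * outDegree v ^ ℓ) ∎
        where
        open ≡-Reasoning
        Cs = blocks w lo m
        Ts = tuples vertices ℓ

      module _ (Δ s w c : ℕ) where

        bad : List (Fin N) → ℕ
        bad ts = #exceptional T (commonInNeighbours w c ts) B Δ s

        bad≡∑ : ∀ ts → bad ts ≡ ∑ (subsets N) (λ S → 𝟙 (exceptional? T (commonInNeighbours w c ts) B Δ s S))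
        bad≡∑ ts = length-filter (exceptional? T (commonInNeighbours w c ts) B Δ s) (subsets N)

        exceptional⇒hasSize : ∀ ts {S} → Exceptional T (commonInNeighbours w c ts) B Δ s S →
                              S hasSize Δ inside interval σ c (c + w)
        exceptional⇒hasSize ts (S⊆A , ∣S∣≡Δ , _) = (λ x∈S → commonInNeighbours⊆interval w c ts (S⊆A x∈S)) , ∣S∣≡Δ

        bad≤C : ∀ ts → bad ts ≤ ∣ interval σ c (c + w) ∣ C Δ
        bad≤C ts = begin
          bad ts
            ≡⟨ bad≡∑ ts ⟩
          ∑ (subsets N) (λ S → 𝟙 (exceptional? T (commonInNeighbours w c ts) B Δ s S))
            ≤⟨ ∑-mono (subsets N) (λ S → 𝟙-mono (exceptional? T (commonInNeighbours w c ts) B Δ s S)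
                 (hasSize? (interval σ c (c + w)) Δ S) (exceptional⇒hasSize ts)) ⟩
          ∑ (subsets N) (λ S → 𝟙 (hasSize? (interval σ c (c + w)) Δ S))
            ≡⟨ ∑-subsets (interval σ c (c + w)) Δ ⟩
          ∣ interval σ c (c + w) ∣ C Δ ∎
          where open ≤-Reasoning

        -- S lies in the common in-neighbourhood of the tuple ts exactly when
        -- every entry of ts lies in N⁺ S, so at most |N⁺ S ∩ B|^ℓ tuples count S.
        ∑-tuples-exceptional : ∀ ℓ S →
          ∑ (tuples vertices ℓ) (λ ts → 𝟙 (exceptional? T (commonInNeighbours w c ts) B Δ s S)) ≤
          𝟙 (hasSize? (interval σ c (c + w)) Δ S) * s ^ ℓ
        ∑-tuples-exceptional ℓ S with s + 1 ≤? ∣ N⁺ T S ∩ B ∣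
        ... | yes s<∣N⁺S∩B∣ = ≤-trans (≤-reflexive (∑-empty (λ ts → exceptional? T (commonInNeighbours w c ts) B Δ s S)
                                (tuples vertices ℓ) λ ts (_ , _ , s≮) → s≮ s<∣N⁺S∩B∣)) z≤n
        ... | no s≮∣N⁺S∩B∣ = begin
          ∑ Ts (λ ts → 𝟙 (exceptional? T (commonInNeighbours w c ts) B Δ s S))
            ≤⟨ ∑-mono Ts (λ ts → ≤-trans
                 (𝟙-mono (exceptional? T (commonInNeighbours w c ts) B Δ s S)
                         (hasSize? (interval σ c (c + w)) Δ S ×-dec all? (_∈? N⁺ T S) ts)
                         (λ exc → exceptional⇒hasSize ts exc , ts∈N⁺S ts (proj₁ exc)))
                 (≤-reflexive (𝟙-× (hasSize? (interval σ c (c + w)) Δ S) (all? (_∈? N⁺ T S) ts)))) ⟩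
          ∑ Ts (λ ts → h * 𝟙 (all? (_∈? N⁺ T S) ts))
            ≡⟨ *-distribˡ-∑ h Ts _ ⟨
          h * ∑ Ts (λ ts → 𝟙 (all? (_∈? N⁺ T S) ts))
            ≡⟨ cong (h *_) (∑-tuples (_∈? N⁺ T S) vertices ℓ) ⟩
          h * ∑ vertices (λ t → 𝟙 (t ∈? N⁺ T S)) ^ ℓ
            ≤⟨ *-monoʳ-≤ h (^-monoˡ-≤ ℓ (≤-trans ∑≤∣N⁺S∩B∣ (m<1+n⇒m≤n (subst (∣ N⁺ T S ∩ B ∣ <_) (+-comm s 1) (≰⇒> s≮∣N⁺S∩B∣))))) ⟩
          h * s ^ ℓ ∎
          where
          open ≤-Reasoning
          Ts : List (List (Fin N))
          Ts = tuples vertices ℓ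
          h : ℕ
          h = 𝟙 (hasSize? (interval σ c (c + w)) Δ S)
          ts∈N⁺S : ∀ ts → S ⊆ commonInNeighbours w c ts → All (_∈ N⁺ T S) ts
          ts∈N⁺S ts S⊆A = All.tabulate λ t∈ts → ∈⟦⟧⁺ (λ t → allᶠ? (λ v → (v ∈? S) →-dec (v ⟶? t))) λ v v∈S →
            All.lookup (proj₂ (∈⟦⟧⁻ (λ v → (index σ v ∈?[ c , c + w ⟩) ×-dec all? (v ⟶?_) ts) (S⊆A v∈S))) t∈ts
          ∑≤∣N⁺S∩B∣ : ∑ vertices (λ t → 𝟙 (t ∈? N⁺ T S)) ≤ ∣ N⁺ T S ∩ B ∣
          ∑≤∣N⁺S∩B∣ = begin
            ∑ vertices (λ t → 𝟙 (t ∈? N⁺ T S))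
              ≡⟨ ∑-filter (_∈? B) (allFin N) _ ⟩
            ∑ (allFin N) (λ t → 𝟙 (t ∈? B) * 𝟙 (t ∈? N⁺ T S))
              ≡⟨ ∑-cong (allFin N) (λ t → 𝟙-× (t ∈? B) (t ∈? N⁺ T S)) ⟨
            ∑ (allFin N) (λ t → 𝟙 ((t ∈? B) ×-dec (t ∈? N⁺ T S)))
              ≤⟨ ∑-mono (allFin N) (λ t → 𝟙-mono ((t ∈? B) ×-dec (t ∈? N⁺ T S)) (t ∈? (N⁺ T S ∩ B))
                   (λ (t∈B , t∈N⁺S) → x∈p∩q⁺ (t∈N⁺S , t∈B))) ⟩
            ∑ (allFin N) (λ t → 𝟙 (t ∈? (N⁺ T S ∩ B)))
              ≡⟨ ∣p∣≡∑ (N⁺ T S ∩ B) ⟨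
            ∣ N⁺ T S ∩ B ∣ ∎

        ∑-bad : ∀ ℓ → ∑ (tuples vertices ℓ) bad ≤ (∣ interval σ c (c + w) ∣ C Δ) * s ^ ℓ
        ∑-bad ℓ = begin
          ∑ (tuples vertices ℓ) bad
            ≡⟨ ∑-cong (tuples vertices ℓ) bad≡∑ ⟩
          ∑ (tuples vertices ℓ) (λ ts → ∑ (subsets N) (λ S → 𝟙 (exceptional? T (commonInNeighbours w c ts) B Δ s S)))
            ≡⟨ ∑-comm (tuples vertices ℓ) (subsets N) _ ⟩
          ∑ (subsets N) (λ S → ∑ (tuples vertices ℓ) (λ ts → 𝟙 (exceptional? T (commonInNeighbours w c ts) B Δ s S)))
            ≤⟨ ∑-mono (subsets N) (∑-tuples-exceptional ℓ) ⟩
          ∑ (subsets N) (λ S → 𝟙 (hasSize? (interval σ c (c + w)) Δ S) * s ^ ℓ)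
            ≡⟨ *-distribʳ-∑ (s ^ ℓ) (subsets N) _ ⟨
          ∑ (subsets N) (λ S → 𝟙 (hasSize? (interval σ c (c + w)) Δ S)) * s ^ ℓ
            ≡⟨ cong (_* s ^ ℓ) (∑-subsets (interval σ c (c + w)) Δ) ⟩
          (∣ interval σ c (c + w) ∣ C Δ) * s ^ ℓ ∎
          where open ≤-Reasoning

  ^-distribʳ-* : ∀ m n o → (m * n) ^ o ≡ m ^ o * n ^ o
  ^-distribʳ-* m n zero    = refl
  ^-distribʳ-* m n (suc o) = trans (cong (m * n *_) (^-distribʳ-* m n o)) (interchange m n (m ^ o) (n ^ o))
    where
    interchange : ∀ a b c d → a * b * (c * d) ≡ a * c * (b * d)
    interchange = solve-∀

  -- The pair (c , t) is found by averaging 4DPα − wqβb, which bounds the size α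
  -- from below and the weight b from above at once.
  averaging : ∀ {A B : Set} (Cs : List A) (Ts : List B) (α b : A → B → ℕ) {w P q D β} →
    .{{_ : NonZero w}} .{{_ : NonZero q}} .{{_ : NonZero D}} →
    0 < length Cs → 0 < length Ts → β ≤ length Ts →
    length Cs * length Ts * (w * q) ≤ P * ∑ Cs (λ c → ∑ Ts (α c)) →
    (∀ {c} → c ∈ˡ Cs → ∀ t → α c t ≤ w) →
    (∀ {c} → c ∈ˡ Cs → ∑ Ts (b c) ≤ D) →
    ∃[ c ] ∃[ t ] c ∈ˡ Cs × w * q ≤ 2 * P * α c t × q * β * b c t ≤ 4 * P * D
  averaging Cs Ts α b {w} {P} {q} {D} {β} 0<L 0<R β≤R many α≤w ∑b≤D =
    c , t , c∈Cs , large , few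
    where
    open ≤-Reasoning
    L R : ℕ
    L = length Cs
    R = length Ts

    f g : _ → _ → ℕ
    f c t = w * q * β * b c t + 2 * D * (w * q)
    g c t = 4 * D * P * α c t

    ∑f≤ : ∀ {c} → c ∈ˡ Cs → ∑ Ts (f c) ≤ 3 * D * (w * q) * R
    ∑f≤ {c} c∈ = begin
      ∑ Ts (f c)
        ≡⟨ ∑-distrib-+ Ts _ _ ⟩
      ∑ Ts (λ t → w * q * β * b c t) + ∑ Ts (λ _ → 2 * D * (w * q))
        ≡⟨ cong₂ _+_ (sym (*-distribˡ-∑ (w * q * β) Ts (b c))) (∑-const Ts _) ⟩
      w * q * β * ∑ Ts (b c) + R * (2 * D * (w * q))
        ≤⟨ +-monoˡ-≤ _ (*-mono-≤ (*-monoʳ-≤ (w * q) β≤R) (∑b≤D c∈)) ⟩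
      w * q * R * D + R * (2 * D * (w * q))
        ≡⟨ identity (w * q) R D ⟩
      3 * D * (w * q) * R ∎
      where
      identity : ∀ u R D → u * R * D + R * (2 * D * u) ≡ 3 * D * u * R
      identity = solve-∀

    total : ∑ Cs (λ c → ∑ Ts (f c)) < ∑ Cs (λ c → ∑ Ts (g c))
    total = begin-strict
      ∑ Cs (λ c → ∑ Ts (f c))
        ≤⟨ ∑-mono-∈ Cs ∑f≤ ⟩
      ∑ Cs (λ _ → 3 * D * (w * q) * R)
        ≡⟨ ∑-const Cs _ ⟩
      L * (3 * D * (w * q) * R)
        <⟨ m<m+n _ (>-nonZero⁻¹ (L * R * (w * q) * D)) ⟩
      L * (3 * D * (w * q) * R) + L * R * (w * q) * D
        ≡⟨ identity L D (w * q) R ⟩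
      4 * D * (L * R * (w * q))
        ≤⟨ *-monoʳ-≤ (4 * D) many ⟩
      4 * D * (P * ∑ Cs (λ c → ∑ Ts (α c)))
        ≡⟨ *-assoc (4 * D) P _ ⟨
      4 * D * P * ∑ Cs (λ c → ∑ Ts (α c))
        ≡⟨ *-distribˡ-∑ (4 * D * P) Cs _ ⟩
      ∑ Cs (λ c → 4 * D * P * ∑ Ts (α c))
        ≡⟨ ∑-cong Cs (λ c → *-distribˡ-∑ (4 * D * P) Ts (α c)) ⟩
      ∑ Cs (λ c → ∑ Ts (g c)) ∎
      where
      instance
        wq≢0 : NonZero (w * q)
        wq≢0 = m*n≢0 w q
        LR≢0 : NonZero (L * R)
        LR≢0 = m*n≢0 L R {{>-nonZero 0<L}} {{>-nonZero 0<R}}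
        LRwq≢0 : NonZero (L * R * (w * q))
        LRwq≢0 = m*n≢0 (L * R) (w * q)
        LRwqD≢0 : NonZero (L * R * (w * q) * D)
        LRwqD≢0 = m*n≢0 (L * R * (w * q)) D
      identity : ∀ L D u R → L * (3 * D * u * R) + L * R * u * D ≡ 4 * D * (L * R * u)
      identity = solve-∀

    pair : ∃[ c ] ∃[ t ] c ∈ˡ Cs × f c t < g c t
    pair = let c , c∈ , ∑f<∑g = ∑-<⇒∃< Cs total
               t , _ , f<g = ∑-<⇒∃< Ts ∑f<∑g in c , t , c∈ , f<g
    c = proj₁ pair
    t = proj₁ (proj₂ pair)
    c∈Cs = proj₁ (proj₂ (proj₂ pair))
    f≤g : f c t ≤ g c t
    f≤g = <⇒≤ (proj₂ (proj₂ (proj₂ pair)))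

    large : w * q ≤ 2 * P * α c t
    large = *-cancelˡ-≤ (2 * D) {{m*n≢0 2 D}} (begin
      2 * D * (w * q)          ≤⟨ m≤n+m _ (w * q * β * b c t) ⟩
      f c t                    ≤⟨ f≤g ⟩
      g c t                    ≡⟨ identity D P (α c t) ⟩
      2 * D * (2 * P * α c t)  ∎)
      where
      identity : ∀ D P x → 4 * D * P * x ≡ 2 * D * (2 * P * x)
      identity = solve-∀

    few : q * β * b c t ≤ 4 * P * D
    few = *-cancelˡ-≤ w (begin
      w * (q * β * b c t)  ≡⟨ identity₁ w q β (b c t) ⟩
      w * q * β * b c t    ≤⟨ m≤m+n _ (2 * D * (w * q)) ⟩
      f c t                ≤⟨ f≤g ⟩
      g c t                ≤⟨ *-monoʳ-≤ (4 * D * P) (α≤w c∈Cs t) ⟩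
      4 * D * P * w        ≡⟨ identity₂ D P w ⟩
      w * (4 * P * D)      ∎)
      where
      identity₁ : ∀ w q β x → w * (q * β * x) ≡ w * q * β * x
      identity₁ = solve-∀
      identity₂ : ∀ D P w → 4 * D * P * w ≡ w * (4 * P * D)
      identity₂ = solve-∀

  module _ {N : ℕ} (T : Tournament N) (σ : Ordering {N}) (median : IsMedianOrder T σ)
           (B : Subset N) (K w lo : ℕ) (1≤lo : 1 ≤ lo)
           (B⊆ : B ⊆ interval σ (lo + 2 * suc K * w) (lo + 2 * suc K * w + 2 * w)) where
    open Tournament T

    private
      M j : ℕ
      M = 2 * suc K
      j = lo + M * w
      window? : ∀ v → _
      window? v = index σ v ∈?[ lo , j ⟩
      window : List (Fin N)
      window = filter window? (allFin N)
      d : Fin N → ℕ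
      d = outDegree T σ B

    ∑-outDegree : ∣ B ∣ * (K * w) ≤ ∑ window d
    ∑-outDegree = begin
      ∣ B ∣ * (K * w)
        ≡⟨ cong (_* (K * w)) (length-vertices T σ B) ⟨
      length (vertices T σ B) * (K * w)
        ≡⟨ ∑-const (vertices T σ B) (K * w) ⟨
      ∑ (vertices T σ B) (λ _ → K * w)
        ≤⟨ ∑-mono-∈ (vertices T σ B) (λ {t} t∈ →
             let j≤t , t<j+2w = ∈⟦⟧⁻ (λ v → index σ v ∈?[ j , j + 2 * w ⟩) (B⊆ (proj₂ (∈-filter⁻ (_∈? B) {xs = allFin N} t∈)))
             in ≤-trans (median-inNeighbours-window T σ median K w lo t 1≤lo j≤t t<j+2w)
                  (≤-reflexive (sym (∑-filter window? (allFin N) (λ v → 𝟙 (v ⟶? t)))))) ⟩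
      ∑ (vertices T σ B) (λ t → ∑ window (λ v → 𝟙 (v ⟶? t)))
        ≡⟨ ∑-comm (vertices T σ B) window _ ⟩
      ∑ window d ∎
      where open ≤-Reasoning

    ∑-∣commonInNeighbours∣-≥ : j ≤ suc N → ∀ ℓ .{{_ : NonZero ℓ}} →
      M * ∣ B ∣ ^ ℓ * (w * K ^ ℓ) ≤
      M ^ ℓ * ∑ (blocks w lo M) (λ c → ∑ (tuples (vertices T σ B) ℓ) (λ ts → ∣ commonInNeighbours T σ w c ts ∣))
    ∑-∣commonInNeighbours∣-≥ j≤1+N ℓ@(suc p) = begin
      M * ∣ B ∣ ^ ℓ * (w * K ^ ℓ)
        ≡⟨ identity₁ M (∣ B ∣ ^ ℓ) w (K ^ ℓ) ⟩
      M * w * (∣ B ∣ ^ ℓ * K ^ ℓ)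
        ≡⟨ cong₂ _*_ (sym length-window) (sym (^-distribʳ-* ∣ B ∣ K ℓ)) ⟩
      length window * (∣ B ∣ * K) ^ ℓ
        ≤⟨ power-mean window (λ v → M * d v) (∣ B ∣ * K) p (begin
             length window * (∣ B ∣ * K)   ≡⟨ cong (_* (∣ B ∣ * K)) length-window ⟩
             M * w * (∣ B ∣ * K)           ≡⟨ identity₂ M w ∣ B ∣ K ⟩
             M * (∣ B ∣ * (K * w))         ≤⟨ *-monoʳ-≤ M ∑-outDegree ⟩
             M * ∑ window d                ≡⟨ *-distribˡ-∑ M window d ⟩
             ∑ window (λ v → M * d v)      ∎) ⟩
      ∑ window (λ v → (M * d v) ^ ℓ)
        ≡⟨ ∑-cong window (λ v → ^-distribʳ-* M (d v) ℓ) ⟩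
      ∑ window (λ v → M ^ ℓ * d v ^ ℓ)
        ≡⟨ *-distribˡ-∑ (M ^ ℓ) window _ ⟨
      M ^ ℓ * ∑ window (λ v → d v ^ ℓ)
        ≡⟨ cong (M ^ ℓ *_) (trans (∑-filter window? (allFin N) _) (sym (∑-∣commonInNeighbours∣ T σ B w lo M ℓ))) ⟩
      M ^ ℓ * ∑ (blocks w lo M) (λ c → ∑ (tuples (vertices T σ B) ℓ) (λ ts → ∣ commonInNeighbours T σ w c ts ∣)) ∎
      where
      open ≤-Reasoning
      length-window : length window ≡ M * w
      length-window = trans (length-filter window? (allFin N))
        (trans (∑-index-interval σ 1≤lo (m≤m+n lo _) j≤1+N) (m+n∸m≡n lo (M * w)))
      identity₁ : ∀ M n w k → M * n * (w * k) ≡ M * w * (n * k)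
      identity₁ = solve-∀
      identity₂ : ∀ M w n k → M * w * (n * k) ≡ M * (n * (k * w))
      identity₂ = solve-∀

    dependentRandomChoice : ∀ b ℓ s Δ .{{_ : NonZero b}} .{{_ : NonZero ℓ}} .{{_ : NonZero s}} .{{_ : NonZero w}} .{{_ : NonZero K}} →
      b ≤ ∣ B ∣ → j ≤ suc N →
      ∃[ c ] ∃[ ts ] let A = commonInNeighbours T σ w c ts in
        (lo ≤ c × c + w ≤ j) ×
        w * K ^ ℓ ≤ 2 * M ^ ℓ * ∣ A ∣ ×
        K ^ ℓ * b ^ ℓ * #exceptional T A B Δ s ≤ 4 * M ^ ℓ * ((w C Δ) * s ^ ℓ)
    dependentRandomChoice b ℓ s Δ b≤∣B∣ j≤1+N = byCases (w C Δ) refl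
      where
      open ≤-Reasoning
      instance
        K^ℓ≢0 : NonZero (K ^ ℓ)
        K^ℓ≢0 = m^n≢0 K ℓ
        s^ℓ≢0 : NonZero (s ^ ℓ)
        s^ℓ≢0 = m^n≢0 s ℓ
      Cs : List ℕ
      Cs = blocks w lo M
      Ts : List (List (Fin N))
      Ts = tuples (vertices T σ B) ℓ
      length-Ts : length Ts ≡ ∣ B ∣ ^ ℓ
      length-Ts = trans (length-tuples (vertices T σ B) ℓ) (cong (_^ ℓ) (length-vertices T σ B))
      b^ℓ≤length-Ts : b ^ ℓ ≤ length Ts
      b^ℓ≤length-Ts = ≤-trans (^-monoˡ-≤ ℓ b≤∣B∣) (≤-reflexive (sym length-Ts))
      size : ∀ {c} → c ∈ˡ Cs → ∣ interval σ c (c + w) ∣ ≡ w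
      size c∈ = let lo≤c , c+w≤j = ∈-blocks w M c∈ in
        ∣interval∣ T σ (≤-trans 1≤lo lo≤c) (≤-trans c+w≤j j≤1+N)
      many : length Cs * length Ts * (w * K ^ ℓ) ≤
             M ^ ℓ * ∑ Cs (λ c → ∑ Ts (λ ts → ∣ commonInNeighbours T σ w c ts ∣))
      many = begin
        length Cs * length Ts * (w * K ^ ℓ)
          ≡⟨ cong₂ (λ x y → x * y * (w * K ^ ℓ)) (length-blocks w lo M) length-Ts ⟩
        M * ∣ B ∣ ^ ℓ * (w * K ^ ℓ)
          ≤⟨ ∑-∣commonInNeighbours∣-≥ j≤1+N ℓ ⟩
        M ^ ℓ * ∑ Cs (λ c → ∑ Ts (λ ts → ∣ commonInNeighbours T σ w c ts ∣)) ∎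

      choose : ∀ D .{{_ : NonZero D}} → (∀ {c} → c ∈ˡ Cs → ∑ Ts (bad T σ B Δ s w c) ≤ D) →
        ∃[ c ] ∃[ ts ] c ∈ˡ Cs ×
          w * K ^ ℓ ≤ 2 * M ^ ℓ * ∣ commonInNeighbours T σ w c ts ∣ ×
          K ^ ℓ * b ^ ℓ * bad T σ B Δ s w c ts ≤ 4 * M ^ ℓ * D
      choose D = averaging Cs Ts (λ c ts → ∣ commonInNeighbours T σ w c ts ∣) (bad T σ B Δ s w)
        {P = M ^ ℓ} {q = K ^ ℓ} {β = b ^ ℓ}
        (≤-trans z<s (≤-reflexive (sym (length-blocks w lo M))))
        (<-≤-trans (m^n>0 b ℓ) b^ℓ≤length-Ts) b^ℓ≤length-Ts many
        (λ {c} c∈ ts → ≤-trans (p⊆q⇒∣p∣≤∣q∣ (commonInNeighbours⊆interval T σ w c ts)) (≤-reflexive (size c∈)))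

      byCases : ∀ m → w C Δ ≡ m → ∃[ c ] ∃[ ts ]
        (lo ≤ c × c + w ≤ j) ×
        w * K ^ ℓ ≤ 2 * M ^ ℓ * ∣ commonInNeighbours T σ w c ts ∣ ×
        K ^ ℓ * b ^ ℓ * bad T σ B Δ s w c ts ≤ 4 * M ^ ℓ * (m * s ^ ℓ)
      byCases (suc m) C≡ =
        let c , ts , c∈ , large , few = choose (suc m * s ^ ℓ) {{m*n≢0 (suc m) (s ^ ℓ)}}
              λ {c} c∈ → ≤-trans (∑-bad T σ B Δ s w c ℓ)
                (≤-reflexive (cong (_* s ^ ℓ) (trans (cong (_C Δ) (size c∈)) C≡)))
        in c , ts , ∈-blocks w M c∈ , large , few
      byCases zero C≡ =
        let c , ts , c∈ , large , _ = choose 1 λ {c} c∈ → ≤-trans (∑-bad T σ B Δ s w c ℓ)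
              (≤-trans (≤-reflexive (cong (_* s ^ ℓ) (trans (cong (_C Δ) (size c∈)) C≡))) z≤n)
            bad≡0 = n≤0⇒n≡0 (≤-trans (bad≤C T σ B Δ s w c ts) (≤-reflexive (trans (cong (_C Δ) (size c∈)) C≡)))
        in c , ts , ∈-blocks w M c∈ , large ,
           ≤-trans (≤-reflexive (trans (cong (K ^ ℓ * b ^ ℓ *_) bad≡0) (*-zeroʳ (K ^ ℓ * b ^ ℓ)))) z≤n

open import Defs using (_^_)
open import Data.Integer.Base as ℤ using (+_)
import Data.Integer.Properties as ℤ
open import Data.Nat.Base using () renaming (_*_ to _*ℕ_; _^_ to _^ℕ_)
open import Data.Rational.Base using (_*_; _/_; toℚᵘ) renaming (_≤_ to _≤ℚ_)
open import Data.Rational.Properties using (toℚᵘ-cancel-≤; toℚᵘ-fromℚᵘ; toℚᵘ-homo-*; toℚᵘ-injective)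
open import Data.Rational.Unnormalised.Base as ℚᵘ using (mkℚᵘ; *≤*)
import Data.Rational.Unnormalised.Properties as ℚᵘ

toℚᵘ-/ : ∀ m n .{{_ : NonZero n}} → toℚᵘ (+ m / n) ℚᵘ.≃ + m ℚᵘ./ n
toℚᵘ-/ m (suc n) = toℚᵘ-fromℚᵘ (mkℚᵘ (+ m) n)

/-≤ : ∀ m n o p .{{_ : NonZero n}} .{{_ : NonZero p}} → m *ℕ p ≤ o *ℕ n → + m / n ≤ℚ + o / p
/-≤ m n@(suc _) o p@(suc _) mp≤on = toℚᵘ-cancel-≤ (begin
  toℚᵘ (+ m / n)  ≃⟨ toℚᵘ-/ m n ⟩
  + m ℚᵘ./ n      ≤⟨ *≤* (subst₂ ℤ._≤_ (ℤ.pos-* m p) (ℤ.pos-* o n) (ℤ.+≤+ mp≤on)) ⟩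
  + o ℚᵘ./ p      ≃⟨ toℚᵘ-/ o p ⟨
  toℚᵘ (+ o / p)  ∎)
  where open ℚᵘ.≤-Reasoning

/-* : ∀ m n o p .{{_ : NonZero n}} .{{_ : NonZero p}} .{{_ : NonZero (n *ℕ p)}} →
      (+ m / n) * (+ o / p) ≡ + (m *ℕ o) / (n *ℕ p)
/-* m n@(suc _) o p@(suc _) = toℚᵘ-injective (begin-equality
  toℚᵘ ((+ m / n) * (+ o / p))           ≃⟨ toℚᵘ-homo-* (+ m / n) (+ o / p) ⟩
  toℚᵘ (+ m / n) ℚᵘ.* toℚᵘ (+ o / p)     ≃⟨ ℚᵘ.*-cong (toℚᵘ-/ m n) (toℚᵘ-/ o p) ⟩
  (+ m ℚᵘ./ n) ℚᵘ.* (+ o ℚᵘ./ p)         ≡⟨ cong (ℚᵘ._/ (n *ℕ p)) (sym (ℤ.pos-* m o)) ⟩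
  + (m *ℕ o) ℚᵘ./ (n *ℕ p)               ≃⟨ toℚᵘ-/ (m *ℕ o) (n *ℕ p) ⟨
  toℚᵘ (+ (m *ℕ o) / (n *ℕ p))           ∎)
  where open ℚᵘ.≤-Reasoning

/-^ : ∀ m n ℓ .{{_ : NonZero n}} .{{_ : NonZero (n ^ℕ ℓ)}} → (+ m / n) ^ ℓ ≡ + (m ^ℕ ℓ) / (n ^ℕ ℓ)
/-^ m n zero    = refl
/-^ m n (suc ℓ) = trans (cong (+ m / n *_) (/-^ m n ℓ)) (/-* m n (m ^ℕ ℓ) (n ^ℕ ℓ))
  where
  instance
    n^ℓ≢0 : NonZero (n ^ℕ ℓ)
    n^ℓ≢0 = m^n≢0 n ℓ

size-bound : ∀ w K M ℓ α .{{_ : NonZero M}} → w *ℕ K ^ℕ ℓ ≤ 2 *ℕ M ^ℕ ℓ *ℕ α →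
             (+ w / 2) * (+ K / M) ^ ℓ ≤ℚ fromℕ α
size-bound w K M ℓ α large = subst (_≤ℚ fromℕ α)
  (sym (trans (cong (+ w / 2 *_) (/-^ K M ℓ)) (/-* w 2 (K ^ℕ ℓ) (M ^ℕ ℓ))))
  (/-≤ (w *ℕ K ^ℕ ℓ) (2 *ℕ M ^ℕ ℓ) α 1
    (subst₂ _≤_ (sym (*-identityʳ (w *ℕ K ^ℕ ℓ))) (*-comm (2 *ℕ M ^ℕ ℓ) α) large))
  where
  instance
    M^ℓ≢0 : NonZero (M ^ℕ ℓ)
    M^ℓ≢0 = m^n≢0 M ℓ
    2M^ℓ≢0 : NonZero (2 *ℕ M ^ℕ ℓ)
    2M^ℓ≢0 = m*n≢0 2 (M ^ℕ ℓ)

exception-bound : ∀ r K M ℓ s b β .{{_ : NonZero K}} .{{_ : NonZero b}} →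
                  K ^ℕ ℓ *ℕ b ^ℕ ℓ *ℕ β ≤ 4 *ℕ M ^ℕ ℓ *ℕ (r *ℕ s ^ℕ ℓ) →
                  fromℕ β ≤ℚ fromℕ 4 * (+ M / K) ^ ℓ * fromℕ r * (+ s / b) ^ ℓ
exception-bound r K M ℓ s b β few = subst (fromℕ β ≤ℚ_) (sym fraction)
  (/-≤ β 1 (4 *ℕ m *ℕ r *ℕ s ^ℕ ℓ) (1 *ℕ k *ℕ 1 *ℕ b ^ℕ ℓ)
    (subst₂ _≤_ (lhs β k (b ^ℕ ℓ)) (rhs m r (s ^ℕ ℓ)) few))
  where
  k m : ℕ
  k = K ^ℕ ℓ
  m = M ^ℕ ℓ
  instance
    K^ℓ≢0 : NonZero k
    K^ℓ≢0 = m^n≢0 K ℓ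
    b^ℓ≢0 : NonZero (b ^ℕ ℓ)
    b^ℓ≢0 = m^n≢0 b ℓ
    1K^ℓ≢0 : NonZero (1 *ℕ k)
    1K^ℓ≢0 = m*n≢0 1 k
    1K^ℓ1≢0 : NonZero (1 *ℕ k *ℕ 1)
    1K^ℓ1≢0 = m*n≢0 (1 *ℕ k) 1
    denominator≢0 : NonZero (1 *ℕ k *ℕ 1 *ℕ b ^ℕ ℓ)
    denominator≢0 = m*n≢0 (1 *ℕ k *ℕ 1) (b ^ℕ ℓ)
  lhs : ∀ β k b → k *ℕ b *ℕ β ≡ β *ℕ (1 *ℕ k *ℕ 1 *ℕ b)
  lhs = solve-∀
  rhs : ∀ m r s → 4 *ℕ m *ℕ (r *ℕ s) ≡ 4 *ℕ m *ℕ r *ℕ s *ℕ 1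
  rhs = solve-∀
  fraction : fromℕ 4 * (+ M / K) ^ ℓ * fromℕ r * (+ s / b) ^ ℓ ≡
             + (4 *ℕ m *ℕ r *ℕ s ^ℕ ℓ) / (1 *ℕ k *ℕ 1 *ℕ b ^ℕ ℓ)
  fraction = begin
    fromℕ 4 * (+ M / K) ^ ℓ * fromℕ r * (+ s / b) ^ ℓ
      ≡⟨ cong₂ (λ x y → fromℕ 4 * x * fromℕ r * y) (/-^ M K ℓ) (/-^ s b ℓ) ⟩
    fromℕ 4 * (+ m / k) * fromℕ r * (+ (s ^ℕ ℓ) / (b ^ℕ ℓ))
      ≡⟨ cong (λ x → x * fromℕ r * (+ (s ^ℕ ℓ) / (b ^ℕ ℓ))) (/-* 4 1 m k) ⟩
    (+ (4 *ℕ m) / (1 *ℕ k)) * fromℕ r * (+ (s ^ℕ ℓ) / (b ^ℕ ℓ))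
      ≡⟨ cong (_* (+ (s ^ℕ ℓ) / (b ^ℕ ℓ))) (/-* (4 *ℕ m) (1 *ℕ k) r 1) ⟩
    (+ (4 *ℕ m *ℕ r) / (1 *ℕ k *ℕ 1)) * (+ (s ^ℕ ℓ) / (b ^ℕ ℓ))
      ≡⟨ /-* (4 *ℕ m *ℕ r) (1 *ℕ k *ℕ 1) (s ^ℕ ℓ) (b ^ℕ ℓ) ⟩
    + (4 *ℕ m *ℕ r *ℕ s ^ℕ ℓ) / (1 *ℕ k *ℕ 1 *ℕ b ^ℕ ℓ) ∎
    where open ≡-Reasoning

lemma2p2 : (a a′ b ℓ s N k Δ⁻ : ℕ)
    .{{_ : NonZero a}} .{{_ : NonZero a′}} .{{_ : NonZero b}} .{{_ : NonZero ℓ}}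
    .{{_ : NonZero s}} .{{_ : NonZero N}} .{{_ : NonTrivial k}} .{{_ : NonZero Δ⁻}} →
    a ≤ 2 *ℕ a′ →
    (T : Tournament N) (σ : Ordering) → IsMedianOrder T σ →
    (j : ℕ) → 2 *ℕ k *ℕ a′ < j → j + a ≤ N + 1 →
    (B : Subset N) → B ⊆ interval σ j (j + a) → b ≤ ∣ B ∣ →
    ∃[ j′ ] ∃[ A ]
    (j ≤ j′ + 2 *ℕ k *ℕ a′ × j′ + a′ ≤ j) ×
    A ⊆ interval σ j′ (j′ + a′) ×
    (+ a′ / 2) * [k-1]/[2k] k ^ ℓ ≤ℚ fromℕ ∣ A ∣ ×
    fromℕ (#exceptional T A B Δ⁻ s)
    ≤ℚ fromℕ 4 * [2k]/[k-1] k ^ ℓ * fromℕ (a′ C Δ⁻) * (+ s / b) ^ ℓ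
lemma2p2 a a′ b ℓ s N k@(suc K@(suc _)) Δ a≤2a′ T σ median j 2ka′<j j+a≤N+1 B B⊆ b≤∣B∣ =
  c , A , (j≤c+2ka′ , c+a′≤j) , commonInNeighbours⊆interval T σ a′ c ts ,
  size-bound a′ K (2 *ℕ k) ℓ ∣ A ∣ large ,
  exception-bound (a′ C Δ) K (2 *ℕ k) ℓ s b (#exceptional T A B Δ s) few
  where
  W lo : ℕ
  W = 2 *ℕ k *ℕ a′
  lo = j ∸ W
  lo+W≡j : lo + W ≡ j
  lo+W≡j = m∸n+n≡m (<⇒≤ 2ka′<j)
  lo+W≤1+N : lo + W ≤ suc N
  lo+W≤1+N = ≤-trans (≤-reflexive lo+W≡j)
    (≤-trans (m≤m+n j a) (≤-trans j+a≤N+1 (≤-reflexive (+-comm N 1))))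
  B⊆window : B ⊆ interval σ (lo + W) (lo + W + 2 *ℕ a′)
  B⊆window {v} v∈B = ∈⟦⟧⁺ (λ v → index σ v ∈?[ lo + W , lo + W + 2 *ℕ a′ ⟩)
    (subst (λ i → i ≤ index σ v × index σ v < i + 2 *ℕ a′) (sym lo+W≡j)
      (let j≤v , v<j+a = ∈⟦⟧⁻ (λ v → index σ v ∈?[ j , j + a ⟩) (B⊆ v∈B)
       in j≤v , <-≤-trans v<j+a (+-monoʳ-≤ j a≤2a′)))
  choice = dependentRandomChoice T σ median B K a′ lo (m<n⇒0<n∸m 2ka′<j) B⊆window b ℓ s Δ b≤∣B∣ lo+W≤1+N
  c = proj₁ choice
  ts = proj₁ (proj₂ choice)
  A = commonInNeighbours T σ a′ c ts
  bounds = proj₂ (proj₂ choice)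
  j≤c+2ka′ : j ≤ c + W
  j≤c+2ka′ = ≤-trans (≤-reflexive (sym lo+W≡j)) (+-monoˡ-≤ W (proj₁ (proj₁ bounds)))
  c+a′≤j : c + a′ ≤ j
  c+a′≤j = ≤-trans (proj₂ (proj₁ bounds)) (≤-reflexive lo+W≡j)
  large = proj₁ (proj₂ bounds)
  few = proj₂ (proj₂ bounds)
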